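{- Let $a_1,a_2\in D$ be nonzero pure quaternions with $|2a_1|\ge|a_2|$ and $N(a_2)\in N(a_1)k^{*2}$, and let $t$ be the integer with $\nu(\pi^t)=\nu(a_2)-\nu(a_1)$. Say that $r\in\mathcal{O}_D$ satisfies the $k$-star conditions if $\left(\frac{N(1-r),\,-N(a_1)}{\mathfrak{p}}\right)=-1$, $N(z)N(a_1)\in k^{*2}$ and $N(z)N(\pi^ta_1)^{ -1}\in\mathcal{O}_k$, where $z=a_1-ra_1\bar r$. Let $e$ be the ramification index of $k/\mathbb{Q}_2$, $u=t+6e$, and let $\mathcal{S}\subseteq\mathcal{O}_k$ be any finite set of representatives of $\mathcal{O}_k/\pi^u\mathcal{O}_k$. Then there exists $r\in\mathcal{O}_D$ satisfying the $k$-star conditions if and only if there exists $\alpha\in\mathcal{S}\oplus\mathcal{S}\omega\oplus\mathcal{S}i\oplus\mathcal{S}i\omega\subseteq\mathcal{O}_D$ satisfying them.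
   Context: $k$ is a dyadic local field of characteristic $0$, $\mathcal{O}_k$ its integers, $\pi$ a uniformizer, $\nu_k$ its normalized valuation, $\left(\frac{x,y}{\mathfrak{p}}\right)$ the Hilbert symbol of $k$. $\Delta\in\mathcal{O}_k^*$ is a unit of minimal quadratic defect ($\Delta=1+4\delta$, $\delta\in\mathcal{O}_k^*$). $D=\left(\frac{\pi,\Delta}{k}\right)$ is the quaternion division algebra with basis $1,i,j,ij$, $i^2=\pi$, $j^2=\Delta$, $ij=-ji$; $\omega=(1+j)/2$. $N$ is the reduced norm, $q\mapsto\bar q$ the canonical involution, $|q|:=|N(q)|_k$, $\nu(q):=\nu_k(N(q))$, and $\mathcal{O}_D=\{q:|q|\le1\}=\mathcal{O}_k\oplus\mathcal{O}_k\omega\oplus\mathcal{O}_ki\oplus\mathcal{O}_ki\omega$. -}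

module Defs where

open import Level using (Level; 0ℓ; suc; _⊔_)
open import Algebra.Bundles using (CommutativeRing; Semiring)
import Algebra.Definitions.RawSemiring as RawSemiringDefinitions
open import Data.Fin.Base using (Fin)
open import Data.Fin.Properties using (nonZeroIndex)
open import Data.Integer.Base as ℤ using (ℤ; +_; -[1+_])
open import Data.Nat.Base as ℕ using (ℕ)
open import Data.Nat.Properties using (m^n≢0)
open import Data.Product using (∃-syntax; _×_; proj₁)
open import Data.Rational.Base as ℚ using (ℚ; 0ℚ; 1ℚ)
open import Data.Sign.Base as Sign using (Sign)
open import Relation.Binary.Construct.Add.Supremum.NonStrict ℤ._≤_ using (_≤⁺_; _≤⊤⁺)
open import Relation.Binary.PropositionalEquality.Core using (_≡_; subst) renaming (sym to ≡-sym)
open import Relation.Nullary.Construct.Add.Supremum using (_⁺; ⊤⁺; [_])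
open import Relation.Nullary.Negation.Core using (¬_)
open import Relation.Unary using (Pred; _∈_; _⊆_; _≐_)

-- ℤ ∪ {∞}, with ∞ = ⊤⁺.
ℤ∞ : Set
ℤ∞ = ℤ ⁺

infixl 6 _+∞_

_+∞_ : ℤ∞ → ℤ∞ → ℤ∞
[ m ] +∞ [ n ] = [ m ℤ.+ n ]
[ _ ] +∞ ⊤⁺    = ⊤⁺
⊤⁺    +∞ _     = ⊤⁺

-- b ^- n is the rational number b⁻ⁿ, with b⁻ⁿ = 0 for n = ∞.
_^-_ : (b : ℕ) .{{_ : ℕ.NonZero b}} → ℤ∞ → ℚ
b ^- [ + n ]      = ℚ._/_ (+ 1) (b ℕ.^ n) {{m^n≢0 b n}}
b ^- [ -[1+ n ] ] = + (b ℕ.^ ℕ.suc n) ℚ./ 1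
b ^- ⊤⁺           = 0ℚ

record Field (c ℓ : Level) : Set (suc (c ⊔ ℓ)) where
  infix 8 _⁻¹

  field
    commutativeRing : CommutativeRing c ℓ

  open CommutativeRing commutativeRing public
  open RawSemiringDefinitions (Semiring.rawSemiring semiring) public using (_^_) renaming (_×_ to _·_)

  -- The inverse is total, with the convention 0⁻¹ = 0.
  field
    _⁻¹      : Carrier → Carrier
    ⁻¹-cong  : ∀ {x y} → x ≈ y → x ⁻¹ ≈ y ⁻¹
    inverseʳ : ∀ {x} → x ≉ 0# → x * x ⁻¹ ≈ 1#
    0⁻¹≈0    : 0# ⁻¹ ≈ 0#
    1≉0      : 1# ≉ 0#

  2# 4# : Carrier
  2# = 1# + 1#
  4# = 2# * 2#

  infixr 8 _^ᶻ_

  _^ᶻ_ : Carrier → ℤ → Carrier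
  x ^ᶻ (+ n)    = x ^ n
  x ^ᶻ -[1+ n ] = (x ^ ℕ.suc n) ⁻¹

  k*² : Pred Carrier (c ⊔ ℓ)
  k*² x = ∃[ y ] y ≉ 0# × x ≈ y * y

  -- A relation rather than a function to {±1}: the value is determined by
  -- whether x X² + y Y² = Z² has a nontrivial solution.  The symbol has no
  -- value when x or y is zero.
  HilbertSolvable : Carrier → Carrier → Set (c ⊔ ℓ)
  HilbertSolvable x y =
    ∃[ X ] ∃[ Y ] ∃[ Z ] ¬ (X ≈ 0# × Y ≈ 0# × Z ≈ 0#) × x * (X * X) + y * (Y * Y) ≈ Z * Z

  HilbertSymbol[_,_]≡_ : Carrier → Carrier → Sign → Set (c ⊔ ℓ)
  HilbertSymbol[ x , y ]≡ Sign.+ = x ≉ 0# × y ≉ 0# × HilbertSolvable x y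
  HilbertSymbol[ x , y ]≡ Sign.- = x ≉ 0# × y ≉ 0# × ¬ HilbertSolvable x y

module _ {c ℓ} (K : Field c ℓ) where

  open Field K

  record IsNormalizedValuation (ν : Carrier → ℤ∞) : Set (c ⊔ ℓ) where
    field
      ν-cong        : ∀ {x y} → x ≈ y → ν x ≡ ν y
      ν-zero        : ν 0# ≡ ⊤⁺
      ν-∞⇒zero      : ∀ {x} → ν x ≡ ⊤⁺ → x ≈ 0#
      ν-*           : ∀ x y → ν (x * y) ≡ ν x +∞ ν y
      -- Equivalent to ν (x + y) ≥ min (ν x) (ν y).
      ν-ultrametric : ∀ n x y → n ≤⁺ ν x → n ≤⁺ ν y → n ≤⁺ ν (x + y)
      ν-onto        : ∃[ x ] ν x ≡ [ + 1 ]

  module Valuation (ν : Carrier → ℤ∞) where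

    𝒪 : Pred Carrier 0ℓ
    𝒪 x = [ + 0 ] ≤⁺ ν x

    𝒪* : Pred Carrier (c ⊔ ℓ)
    𝒪* x = x ∈ 𝒪 × ∃[ y ] y ∈ 𝒪 × x * y ≈ 1#

    𝔭 : Pred Carrier 0ℓ
    𝔭 x = [ + 1 ] ≤⁺ ν x

    _𝒪-ideal : Carrier → Pred Carrier (c ⊔ ℓ)
    (a 𝒪-ideal) x = ∃[ y ] y ∈ 𝒪 × x ≈ a * y

    Cauchy : (ℕ → Carrier) → Set
    Cauchy x = ∀ (b : ℤ) → ∃[ M ] ∀ m n → M ℕ.≤ m → M ℕ.≤ n → [ b ] ≤⁺ ν (x m - x n)

    _⟶_ : (ℕ → Carrier) → Carrier → Set
    x ⟶ l = ∀ (b : ℤ) → ∃[ M ] ∀ m → M ℕ.≤ m → [ b ] ≤⁺ ν (x m - l)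

    Complete : Set c
    Complete = ∀ x → Cauchy x → ∃[ l ] x ⟶ l

    -- A finite set containing exactly one element of each class of 𝒪/I.
    record Representatives {i} (I : Pred Carrier i) : Set (c ⊔ i) where
      field
        size     : ℕ
        rep      : Fin size → Carrier
        integral : ∀ a → rep a ∈ 𝒪
        covers   : ∀ x → x ∈ 𝒪 → ∃[ a ] (x - rep a) ∈ I
        distinct : ∀ a b → (rep a - rep b) ∈ I → a ≡ b

    -- The quadratic defect of ξ: the intersection of the ideals α𝒪 over all
    -- expressions ξ = η² + α.
    𝔡 : Carrier → Pred Carrier (c ⊔ ℓ)
    𝔡 ξ x = ∀ η α → ξ ≈ η * η + α → x ∈ α 𝒪-ideal

    NonzeroIdeal : Pred Carrier (c ⊔ ℓ) → Set (c ⊔ ℓ)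
    NonzeroIdeal I = ∃[ x ] x ∈ I × x ≉ 0#

    -- A unit whose quadratic defect is minimal among the nonzero quadratic
    -- defects of units.
    record IsMinimalDefectUnit (Δ : Carrier) : Set (c ⊔ ℓ) where
      field
        unit    : Δ ∈ 𝒪*
        nonzero : NonzeroIdeal (𝔡 Δ)
        minimal : ∀ ε → ε ∈ 𝒪* → NonzeroIdeal (𝔡 ε) → 𝔡 Δ ⊆ 𝔡 ε

record DyadicLocalField (c ℓ : Level) : Set (suc (c ⊔ ℓ)) where
  field
    fieldK : Field c ℓ

  open Field fieldK public

  field
    νₖ              : Carrier → ℤ∞
    νₖ-isValuation  : IsNormalizedValuation fieldK νₖ

  open IsNormalizedValuation νₖ-isValuation public
  open Valuation fieldK νₖ public

  field
    complete        : Complete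
    residueField    : Representatives 𝔭
    residueChar2    : 2# ∈ 𝔭
    characteristic0 : ∀ n → n · 1# ≈ 0# → n ≡ 0

  residueCardinality : ℕ
  residueCardinality = Representatives.size residueField

  residueCardinality-nonZero : ℕ.NonZero residueCardinality
  residueCardinality-nonZero = nonZeroIndex (proj₁ (Representatives.covers residueField 0# 0∈𝒪))
    where
    0∈𝒪 : 0# ∈ 𝒪
    0∈𝒪 = subst ([ + 0 ] ≤⁺_) (≡-sym ν-zero) ([ + 0 ] ≤⊤⁺)

  -- The normalized absolute value, |x| = (#𝒪/𝔭)^(-ν x).
  ∣_∣ₖ : Carrier → ℚ
  ∣ x ∣ₖ = _^-_ residueCardinality {{residueCardinality-nonZero}} (νₖ x)

  IsUniformizer : Carrier → Set
  IsUniformizer π = νₖ π ≡ [ + 1 ]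

  -- The prime 2 of ℤ₂ generates in 𝒪 the e-th power of the maximal ideal π𝒪.
  IsRamificationIndex : Carrier → ℕ → Set (c ⊔ ℓ)
  IsRamificationIndex π e = (2# 𝒪-ideal) ≐ ((π ^ e) 𝒪-ideal)

module QuaternionAlgebra {c ℓ} (k : DyadicLocalField c ℓ) (π Δ : DyadicLocalField.Carrier k) where

  open DyadicLocalField k

  -- Coordinates with respect to the basis 1, i, j, ij.
  record D : Set c where
    constructor quat
    field
      x₀ x₁ x₂ x₃ : Carrier

  open D public

  infix  4 _≈ᴰ_ _≉ᴰ_
  infixl 6 _+ᴰ_ _-ᴰ_
  infixl 7 _*ᴰ_

  _≈ᴰ_ _≉ᴰ_ : D → D → Set ℓ
  p ≈ᴰ q = x₀ p ≈ x₀ q × x₁ p ≈ x₁ q × x₂ p ≈ x₂ q × x₃ p ≈ x₃ q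
  p ≉ᴰ q = ¬ (p ≈ᴰ q)

  _+ᴰ_ _-ᴰ_ : D → D → D
  quat a₀ a₁ a₂ a₃ +ᴰ quat b₀ b₁ b₂ b₃ = quat (a₀ + b₀) (a₁ + b₁) (a₂ + b₂) (a₃ + b₃)
  quat a₀ a₁ a₂ a₃ -ᴰ quat b₀ b₁ b₂ b₃ = quat (a₀ - b₀) (a₁ - b₁) (a₂ - b₂) (a₃ - b₃)

  -- Determined by i² = π, j² = Δ, ij = -ji; hence (ij)² = -πΔ, i(ij) = πj,
  -- (ij)i = -πj, (ij)j = Δi and j(ij) = -Δi.
  _*ᴰ_ : D → D → D
  quat a₀ a₁ a₂ a₃ *ᴰ quat b₀ b₁ b₂ b₃ = quat
    (a₀ * b₀ + π * (a₁ * b₁) + Δ * (a₂ * b₂) - (π * Δ) * (a₃ * b₃))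
    (a₀ * b₁ + a₁ * b₀ + Δ * (a₃ * b₂) - Δ * (a₂ * b₃))
    (a₀ * b₂ + a₂ * b₀ + π * (a₁ * b₃) - π * (a₃ * b₁))
    (a₀ * b₃ + a₃ * b₀ + a₁ * b₂ - a₂ * b₁)

  ι : Carrier → D
  ι x = quat x 0# 0# 0#

  0ᴰ 1ᴰ i j ω : D
  0ᴰ = ι 0#
  1ᴰ = ι 1#
  i  = quat 0# 1# 0# 0#
  j  = quat 0# 0# 1# 0#
  ω  = ι (2# ⁻¹) *ᴰ (1ᴰ +ᴰ j)

  conj : D → D
  conj (quat a₀ a₁ a₂ a₃) = quat a₀ (- a₁) (- a₂) (- a₃)

  -- q q̄ lies in k, so only its first coordinate matters.
  N : D → Carrier
  N q = x₀ (q *ᴰ conj q)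

  IsPure : D → Set ℓ
  IsPure q = x₀ q ≈ 0#

  ν : D → ℤ∞
  ν q = νₖ (N q)

  ∣_∣ : D → ℚ
  ∣ q ∣ = ∣ N q ∣ₖ

  𝒪ᴰ : Pred D 0ℓ
  𝒪ᴰ q = ∣ q ∣ ℚ.≤ 1ℚ

  record KStar (a₁ : D) (t : ℤ) (r : D) : Set (c ⊔ ℓ) where
    z : D
    z = a₁ -ᴰ r *ᴰ a₁ *ᴰ conj r

    field
      symbol : HilbertSymbol[ N (1ᴰ -ᴰ r) , - N a₁ ]≡ Sign.-
      square : (N z * N a₁) ∈ k*²
      bound  : (N z * N (ι (π ^ᶻ t) *ᴰ a₁) ⁻¹) ∈ 𝒪

  -- The set S ⊕ Sω ⊕ Si ⊕ Siω.
  Grid : ∀ {ℓ′} {I : Pred Carrier ℓ′} → Representatives I → Pred D ℓ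
  Grid S q = ∃[ a ] ∃[ b ] ∃[ c ] ∃[ d ]
    q ≈ᴰ ι (rep a) +ᴰ ι (rep b) *ᴰ ω +ᴰ ι (rep c) *ᴰ i +ᴰ ι (rep d) *ᴰ (i *ᴰ ω)
    where open Representatives S

{-# OPTIONS --safe #-}

-- Write A = N a₁, n = N (1 - r), N z = w² A and M = N r - 1, and let Q be the norm of the component of r
-- orthogonal to k(a₁).  Then w² - M² = 4Q, the element n is the sum of Q and a norm from k(a₁), and n · N (1 + r)
-- is such a norm.  If r satisfies the star conditions, n is not a norm from k(a₁), and since D is a division
-- algebra, -Q is not a square.  By the local square theorem, w cannot be much smaller than M, nor Q much smaller
-- than the norm n - Q, nor can N (1 + r) be too close to 4.  This bounds the valuation of w by 6e - 1 and that of
-- n by 6e + 1.  As u = t + 6e ≥ 7e, replacing r by an element congruent to it modulo π^u therefore changes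
-- N (1 - r) and N z only by square factors of units.
module Submission where

open import Defs
open import Algebra.Bundles using (CommutativeRing)
import Algebra.Properties.AbelianGroup as AbelianGroupProperties
import Algebra.Properties.Group as GroupProperties
import Algebra.Properties.Ring as RingProperties
import Algebra.Properties.Semiring.Mult.TCOptimised as Mult
import Algebra.Solver.Ring as RingSolver
open import Algebra.Solver.Ring.AlmostCommutativeRing using (AlmostCommutativeRing; fromCommutativeRing; _-Raw-AlmostCommutative⟶_)
open import Data.Empty using (⊥-elim)
open import Data.Fin.Base using (Fin)
open import Data.Integer.Base as ℤ using (ℤ; +_; -[1+_])
import Data.Integer.DivMod as ℤ
import Data.Integer.Properties as ℤ
open import Data.Integer.Tactic.RingSolver using () renaming (solve to ℤ-solve)
open import Data.List.Base using ([]; _∷_)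
open import Data.Maybe.Base using (Maybe; just; nothing)
open import Data.Nat.Base as ℕ using (ℕ)
import Data.Nat.Properties as ℕ
open import Data.Product using (∃-syntax; _×_; _,_; proj₁; proj₂)
open import Data.Rational.Base as ℚ using (ℚ; 1ℚ)
import Data.Rational.Properties as ℚ
open import Data.Rational.Unnormalised.Base as ℚᵘ using (mkℚᵘ)
import Data.Rational.Unnormalised.Properties as ℚᵘ
open import Data.Sum.Base using (_⊎_; inj₁; inj₂)
open import Function.Bundles using (_⇔_; mk⇔)
open import Relation.Binary.Construct.Add.Supremum.NonStrict ℤ._≤_ using (_≤⁺_; _≤⊤⁺; [_]; [≤]-injective; ≤⁺-trans)
open import Relation.Binary.PropositionalEquality.Core as ≡ using (_≡_)
open import Relation.Nullary.Construct.Add.Supremum using (⊤⁺; [_]; []-injective)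
open import Relation.Nullary.Decidable using (yes; no)
open import Relation.Nullary.Negation.Core using (¬_; contradiction)
open import Relation.Unary using (Pred; _∈_)

-- The star conditions are open in r, but the admissible perturbation shrinks as N (1 - r) or N z
-- tends to 0. A fixed modulus works because the symbol -1 keeps both valuations bounded
-- independently of r. Norms from the unramified extension have even valuation and π times such
-- norms odd valuation. Hence the trace of a quaternion has at least half the valuation of its norm,
-- and ν (N (s - r)) ≥ 2u yields first-order changes of order u. For N (1 - r) the local square
-- theorem then asks for u ≥ 3e + 2e + 2, where 3e is half of ν (n) and 2 is rounding. For N z it
-- asks for u ≥ (6e - 1) + e + 1; the term is e and not 2e because z is pure, which doubles the
-- first-order change. Both are met once u ≥ 7e. That t ≥ e comes from |2a₁| ≥ |a₂|, since ν (a₂) =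
-- 2t + ν (a₁).

module IntegerCoefficients {c ℓ} (R : CommutativeRing c ℓ) where

  open CommutativeRing R
  open Mult semiring using (×-homo-+; ×1-homo-*; 1+×) renaming (_×_ to _·_)
  open RingProperties ring
  open GroupProperties +-group using (⁻¹-involutive; ε⁻¹≈ε)
  open AbelianGroupProperties +-abelianGroup using (⁻¹-∙-comm)
  open import Relation.Binary.Reasoning.Setoid setoid

  -- Coefficients are taken in ℤ, where equality is decidable, so that the solver can cancel
  -- numerals such as 2 and 4 over an arbitrary commutative ring.
  fromℤ : ℤ → Carrier
  fromℤ (+ n)    = n · 1#
  fromℤ -[1+ n ] = - (ℕ.suc n · 1#)

  fromℤ-neg : ∀ m → fromℤ (ℤ.- m) ≈ - fromℤ m
  fromℤ-neg (+ 0)           = sym ε⁻¹≈ε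
  fromℤ-neg (+ ℕ.suc n)     = refl
  fromℤ-neg -[1+ n ]        = sym (⁻¹-involutive _)

  fromℤ-⊖ : ∀ m n → fromℤ (m ℤ.⊖ n) ≈ m · 1# - n · 1#
  fromℤ-⊖ ℕ.zero    ℕ.zero    = sym (-‿inverseʳ 0#)
  fromℤ-⊖ ℕ.zero    (ℕ.suc n) = sym (+-identityˡ _)
  fromℤ-⊖ (ℕ.suc m) ℕ.zero    = sym (trans (+-congˡ ε⁻¹≈ε) (+-identityʳ _))
  fromℤ-⊖ (ℕ.suc m) (ℕ.suc n) = begin
    fromℤ (ℕ.suc m ℤ.⊖ ℕ.suc n)         ≡⟨ ≡.cong fromℤ (ℤ.[1+m]⊖[1+n]≡m⊖n m n) ⟩
    fromℤ (m ℤ.⊖ n)                     ≈⟨ fromℤ-⊖ m n ⟩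
    m · 1# - n · 1#                     ≈⟨ +-congʳ (+-identityʳ _) ⟨
    m · 1# + 0# - n · 1#                ≈⟨ +-congʳ (+-congˡ (-‿inverseʳ 1#)) ⟨
    m · 1# + (1# - 1#) - n · 1#         ≈⟨ +-congʳ (+-assoc _ _ _) ⟨
    m · 1# + 1# - 1# - n · 1#           ≈⟨ +-congʳ (+-congʳ (+-comm _ _)) ⟩
    1# + m · 1# - 1# - n · 1#           ≈⟨ +-assoc _ _ _ ⟩
    1# + m · 1# + (- 1# - n · 1#)       ≈⟨ +-congˡ (⁻¹-∙-comm _ _) ⟩
    1# + m · 1# - (1# + n · 1#)         ≈⟨ +-cong (1+× m 1#) (-‿cong (1+× n 1#)) ⟨
    ℕ.suc m · 1# - ℕ.suc n · 1#         ∎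

  fromℤ-+ : ∀ m n → fromℤ (m ℤ.+ n) ≈ fromℤ m + fromℤ n
  fromℤ-+ (+ m)    (+ n)    = ×-homo-+ 1# m n
  fromℤ-+ (+ m)    -[1+ n ] = fromℤ-⊖ m (ℕ.suc n)
  fromℤ-+ -[1+ m ] (+ n)    = trans (fromℤ-⊖ n (ℕ.suc m)) (+-comm _ _)
  fromℤ-+ -[1+ m ] -[1+ n ] = begin
    - (ℕ.suc (ℕ.suc (m ℕ.+ n)) · 1#)    ≡⟨ ≡.cong (λ k → - (ℕ.suc k · 1#)) (≡.sym (ℕ.+-suc m n)) ⟩
    - ((ℕ.suc m ℕ.+ ℕ.suc n) · 1#)      ≈⟨ -‿cong (×-homo-+ 1# (ℕ.suc m) (ℕ.suc n)) ⟩
    - (ℕ.suc m · 1# + ℕ.suc n · 1#)     ≈⟨ ⁻¹-∙-comm _ _ ⟨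
    - (ℕ.suc m · 1#) - ℕ.suc n · 1#     ∎

  fromℤ-+* : ∀ m n → fromℤ (+ m ℤ.* + n) ≈ m · 1# * (n · 1#)
  fromℤ-+* m n = trans (reflexive (≡.cong fromℤ (≡.sym (ℤ.pos-* m n)))) (×1-homo-* m n)

  fromℤ-* : ∀ m n → fromℤ (m ℤ.* n) ≈ fromℤ m * fromℤ n
  fromℤ-* (+ m)    (+ n)    = fromℤ-+* m n
  fromℤ-* (+ m)    -[1+ n ] = begin
    fromℤ (+ m ℤ.* -[1+ n ])            ≡⟨ ≡.cong fromℤ (≡.sym (ℤ.neg-distribʳ-* (+ m) (+ ℕ.suc n))) ⟩
    fromℤ (ℤ.- (+ m ℤ.* + ℕ.suc n))     ≈⟨ fromℤ-neg (+ m ℤ.* + ℕ.suc n) ⟩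
    - fromℤ (+ m ℤ.* + ℕ.suc n)         ≈⟨ -‿cong (fromℤ-+* m (ℕ.suc n)) ⟩
    - (m · 1# * (ℕ.suc n · 1#))         ≈⟨ -‿distribʳ-* _ _ ⟩
    m · 1# * - (ℕ.suc n · 1#)           ∎
  fromℤ-* -[1+ m ] n = begin
    fromℤ (-[1+ m ] ℤ.* n)              ≡⟨ ≡.cong fromℤ (≡.sym (ℤ.neg-distribˡ-* (+ ℕ.suc m) n)) ⟩
    fromℤ (ℤ.- (+ ℕ.suc m ℤ.* n))       ≈⟨ fromℤ-neg (+ ℕ.suc m ℤ.* n) ⟩
    - fromℤ (+ ℕ.suc m ℤ.* n)           ≈⟨ -‿cong (pos n) ⟩
    - (ℕ.suc m · 1# * fromℤ n)          ≈⟨ -‿distribˡ-* _ _ ⟩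
    - (ℕ.suc m · 1#) * fromℤ n          ∎
    where
    pos : ∀ n → fromℤ (+ ℕ.suc m ℤ.* n) ≈ ℕ.suc m · 1# * fromℤ n
    pos (+ n)    = fromℤ-+* (ℕ.suc m) n
    pos -[1+ n ] = fromℤ-* (+ ℕ.suc m) -[1+ n ]

  almostCommutativeRing : AlmostCommutativeRing c ℓ
  almostCommutativeRing = fromCommutativeRing R

  fromℤ-morphism : ℤ.+-*-rawRing -Raw-AlmostCommutative⟶ almostCommutativeRing
  fromℤ-morphism = record
    { ⟦_⟧    = fromℤ
    ; +-homo = fromℤ-+
    ; *-homo = fromℤ-*
    ; -‿homo = fromℤ-neg
    ; 0-homo = refl
    ; 1-homo = refl
    }

  fromℤ-≟ : ∀ m n → Maybe (fromℤ m ≈ fromℤ n)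
  fromℤ-≟ m n with m ℤ.≟ n
  ... | yes m≡n = just (reflexive (≡.cong fromℤ m≡n))
  ... | no  _   = nothing

  open RingSolver ℤ.+-*-rawRing almostCommutativeRing fromℤ-morphism fromℤ-≟ public
    using (Polynomial; solve; _:=_; _:+_; _:*_; _:-_; :-_; con)

  -- Written with the same sums and products as `2#` and `4#`, so that solved equations mention
  -- these definitionally.
  zeroₚ oneₚ twoₚ fourₚ : ∀ {n} → Polynomial n
  zeroₚ = con (+ 0)
  oneₚ  = con (+ 1)
  twoₚ  = oneₚ :+ oneₚ
  fourₚ = twoₚ :* twoₚ

-- Linear inequalities and halving in ℤ.

private module ℤ-+ = GroupProperties (CommutativeRing.+-group ℤ.+-*-commutativeRing)

-- Reduces a linear inequality to a ring identity: a sum of known inequalities is supplied as `a≤b`,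
-- and the solver checks that the differences agree.
≤-by-difference : ∀ {a b c d} → a ℤ.≤ b → d ℤ.- c ≡ b ℤ.- a → c ℤ.≤ d
≤-by-difference a≤b eq = ℤ.0≤i-j⇒j≤i (≡.subst (+ 0 ℤ.≤_) (≡.sym eq) (ℤ.i≤j⇒0≤j-i a≤b))

0≤1 : + 0 ℤ.≤ + 1
0≤1 = ℤ.+≤+ ℕ.z≤n

1≰0 : ¬ (+ 1 ℤ.≤ + 0)
1≰0 (ℤ.+≤+ ())

-- Parity absorbs the extra 1, since m ≥ n + 1 would give 2m ≥ 2n + 2. This handles the odd
-- valuations that π contributes.
halve-≤ : ∀ {m n} → m ℤ.+ m ℤ.≤ + 1 ℤ.+ (n ℤ.+ n) → m ℤ.≤ n
halve-≤ {m} {n} h with m ℤ.≤? n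
... | yes m≤n = m≤n
... | no  m≰n = contradiction (≤-by-difference (ℤ.+-mono-≤ h (ℤ.+-mono-≤ n<m n<m)) (ℤ-solve (m ∷ n ∷ []))) 1≰0
  where
  n<m : + 1 ℤ.+ n ℤ.≤ m
  n<m = ℤ.i<j⇒suc[i]≤j (ℤ.≰⇒> m≰n)

halve-double-≤ : ∀ {m n} → m ℤ.+ m ℤ.≤ n ℤ.+ n → m ℤ.≤ n
halve-double-≤ h = halve-≤ (ℤ.≤-trans h (ℤ.i≤suc[i] _))

halve : ∀ n → ∃[ m ] m ℤ.+ m ℤ.≤ n × n ℤ.≤ + 1 ℤ.+ (m ℤ.+ m)
halve n = m , lower , upper
  where
  m : ℤ
  m = n ℤ./ℕ 2
  remainder : ℤ
  remainder = + (n ℤ.%ℕ 2)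
  double : ∀ i → i ℤ.* + 2 ≡ i ℤ.+ i
  double i = ℤ-solve (i ∷ [])
  n≡ : n ≡ remainder ℤ.+ (m ℤ.+ m)
  n≡ = ≡.trans (ℤ.a≡a%ℕn+[a/ℕn]*n n 2) (≡.cong (λ i → remainder ℤ.+ i) (double m))
  lower : m ℤ.+ m ℤ.≤ n
  lower = ≡.subst (m ℤ.+ m ℤ.≤_) (≡.sym n≡) (ℤ.i≤j+i (m ℤ.+ m) remainder)
  upper : n ℤ.≤ + 1 ℤ.+ (m ℤ.+ m)
  upper = ≡.subst (ℤ._≤ + 1 ℤ.+ (m ℤ.+ m)) (≡.sym n≡) (ℤ.+-monoˡ-≤ (m ℤ.+ m) (ℤ.+≤+ (ℕ.s≤s⁻¹ (ℤ.n%ℕd<d n 2))))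

i≤+∣i∣ : ∀ i → i ℤ.≤ + ℤ.∣ i ∣
i≤+∣i∣ (+ n)    = ℤ.≤-refl
i≤+∣i∣ -[1+ n ] = ℤ.-≤+

-- Arithmetic of the valuation.

module ValuationProperties {c ℓ} (k : DyadicLocalField c ℓ) where

  open DyadicLocalField k
  open IntegerCoefficients commutativeRing
  open RingProperties ring using (-1*x≈-x)
  open import Relation.Binary.Reasoning.Setoid setoid

  infix 4 _≼_
  -- Lower bounds make sense for zero as well, whose valuation is `⊤⁺`, whereas `Val` forces its
  -- argument to be nonzero.
  _≼_ : ℤ → Carrier → Set
  v ≼ x = [ v ] ≤⁺ νₖ x

  Val : Carrier → ℤ → Set
  Val x n = νₖ x ≡ [ n ]

  ≼-cong : ∀ {v x y} → x ≈ y → v ≼ x → v ≼ y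
  ≼-cong x≈y = ≡.subst ([ _ ] ≤⁺_) (ν-cong x≈y)

  ≼-weaken : ∀ {v v′ x} → v′ ℤ.≤ v → v ≼ x → v′ ≼ x
  ≼-weaken v′≤v = ≤⁺-trans ℤ.≤-trans [ v′≤v ]

  val-cong : ∀ {n x y} → x ≈ y → Val x n → Val y n
  val-cong x≈y = ≡.trans (≡.sym (ν-cong x≈y))

  val⇒≼ : ∀ {x n} → Val x n → n ≼ x
  val⇒≼ νx = ≡.subst ([ _ ] ≤⁺_) (≡.sym νx) [ ℤ.≤-refl ]

  val-≤ : ∀ {x n v} → Val x n → v ≼ x → v ℤ.≤ n
  val-≤ νx v≼x = [≤]-injective (≡.subst ([ _ ] ≤⁺_) νx v≼x)

  val-unique : ∀ {x m n} → Val x m → Val x n → m ≡ n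
  val-unique νx νx′ = []-injective (≡.trans (≡.sym νx) νx′)

  ≼-0 : ∀ {v} → v ≼ 0#
  ≼-0 = ≡.subst ([ _ ] ≤⁺_) (≡.sym ν-zero) ([ _ ] ≤⊤⁺)

  val⇒≉0 : ∀ {x n} → Val x n → x ≉ 0#
  val⇒≉0 νx x≈0 with () ← ≡.trans (≡.sym νx) (≡.trans (ν-cong x≈0) ν-zero)

  -- Matching on the value of `νₖ` decides whether x vanishes, so no excluded middle has to be
  -- assumed.
  val? : ∀ x → x ≈ 0# ⊎ ∃[ n ] Val x n
  val? x with νₖ x in eq
  ... | [ n ] = inj₂ (n , ≡.refl)
  ... | ⊤⁺    = inj₁ (ν-∞⇒zero eq)

  ≉0⇒val : ∀ {x} → x ≉ 0# → ∃[ n ] Val x n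
  ≉0⇒val {x} x≉0 with val? x
  ... | inj₁ x≈0 = contradiction x≈0 x≉0
  ... | inj₂ νx  = νx

  ≼? : ∀ v x → v ≼ x ⊎ ∃[ n ] Val x n × + 1 ℤ.+ n ℤ.≤ v
  ≼? v x with val? x
  ... | inj₁ x≈0 = inj₁ (≼-cong (sym x≈0) ≼-0)
  ... | inj₂ (n , νx) with v ℤ.≤? n
  ...   | yes v≤n = inj₁ (≼-weaken v≤n (val⇒≼ νx))
  ...   | no  v≰n = inj₂ (n , νx , ℤ.i<j⇒suc[i]≤j (ℤ.≰⇒> v≰n))

  val-≰ : ∀ {x n} → Val x n → ¬ (+ 1 ℤ.+ n ≼ x)
  val-≰ {n = n} νx h = ℤ.<-irrefl ≡.refl (ℤ.suc[i]≤j⇒i<j (val-≤ νx h))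

  ∀≼⇒≈0 : ∀ {x} → (∀ v → v ≼ x) → x ≈ 0#
  ∀≼⇒≈0 {x} h with val? x
  ... | inj₁ x≈0      = x≈0
  ... | inj₂ (n , νx) = contradiction (h (+ 1 ℤ.+ n)) (val-≰ νx)

  ≼-sandwich : ∀ {x n} → n ≼ x → ¬ (+ 1 ℤ.+ n ≼ x) → Val x n
  ≼-sandwich {x} {n} n≼x ¬h with val? x
  ... | inj₁ x≈0 = contradiction (≼-cong (sym x≈0) ≼-0) ¬h
  ... | inj₂ (m , νx) with m ℤ.≤? n
  ...   | yes m≤n = ≡.trans νx (≡.cong [_] (ℤ.≤-antisym m≤n (val-≤ νx n≼x)))
  ...   | no  m≰n = contradiction (≼-weaken (ℤ.i<j⇒suc[i]≤j (ℤ.≰⇒> m≰n)) (val⇒≼ νx)) ¬h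

  val-* : ∀ {x y m n} → Val x m → Val y n → Val (x * y) (m ℤ.+ n)
  val-* {x} {y} νx νy = ≡.trans (ν-* x y) (≡.cong₂ _+∞_ νx νy)

  ≼-* : ∀ {x y m n} → m ≼ x → n ≼ y → m ℤ.+ n ≼ x * y
  ≼-* {x} {y} m≼x n≼y with val? x | val? y
  ... | inj₁ x≈0 | _        = ≼-cong (sym (trans (*-congʳ x≈0) (zeroˡ y))) ≼-0
  ... | inj₂ _   | inj₁ y≈0 = ≼-cong (sym (trans (*-congˡ y≈0) (zeroʳ x))) ≼-0
  ... | inj₂ (_ , νx) | inj₂ (_ , νy) =
    ≼-weaken (ℤ.+-mono-≤ (val-≤ νx m≼x) (val-≤ νy n≼y)) (val⇒≼ (val-* νx νy))

  ≼-cancelʳ : ∀ {x y v n} → Val y n → v ℤ.+ n ≼ x * y → v ≼ x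
  ≼-cancelʳ {x} {v = v} {n} νy h with val? x
  ... | inj₁ x≈0 = ≼-cong (sym x≈0) ≼-0
  ... | inj₂ (m , νx) = ≼-weaken v≤m (val⇒≼ νx)
    where
    v≤m : v ℤ.≤ m
    v≤m = ≤-by-difference (val-≤ (val-* νx νy) h) (ℤ-solve (m ∷ n ∷ v ∷ []))

  val-1 : Val 1# (+ 0)
  val-1 with n , ν1 ← ≉0⇒val 1≉0 = ≡.trans ν1 (≡.cong [_] n≡0)
    where
    n≡0 : n ≡ + 0
    n≡0 = ℤ-+.identityʳ-unique n n (val-unique (val-cong (*-identityˡ 1#) (val-* ν1 ν1)) ν1)

  -- From (-1)² = 1, twice the valuation of -1 is 0.
  0≼-1 : + 0 ≼ - 1#
  0≼-1 with val? (- 1#)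
  ... | inj₁ -1≈0     = ≼-cong (sym -1≈0) ≼-0
  ... | inj₂ (n , νx) = ≼-weaken (halve-double-≤ (ℤ.≤-reflexive (≡.sym n+n≡0))) (val⇒≼ νx)
    where
    n+n≡0 : n ℤ.+ n ≡ + 0
    n+n≡0 = val-unique (val-cong (solve 0 (:- con (+ 1) :* :- con (+ 1) := con (+ 1)) refl) (val-* νx νx)) val-1

  ≼-neg : ∀ {v x} → v ≼ x → v ≼ - x
  ≼-neg {v} {x} h = ≼-cong (-1*x≈-x x) (≡.subst (_≼ - 1# * x) (ℤ.+-identityˡ v) (≼-* 0≼-1 h))

  ≼-+ : ∀ {v x y} → v ≼ x → v ≼ y → v ≼ x + y
  ≼-+ = ν-ultrametric _ _ _

  ≼-- : ∀ {v x y} → v ≼ x → v ≼ y → v ≼ x - y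
  ≼-- h h′ = ≼-+ h (≼-neg h′)

  val-+ : ∀ {x y n} → Val x n → + 1 ℤ.+ n ≼ y → Val (x + y) n
  val-+ {x} {y} {n} νx h = ≼-sandwich (≼-+ (val⇒≼ νx) (≼-weaken (ℤ.i≤suc[i] n) h))
    λ h′ → val-≰ νx (≼-cong (solve 2 (λ x y → (x :+ y) :- y := x) refl x y) (≼-- h′ h))

  val-neg : ∀ {x n} → Val x n → Val (- x) n
  val-neg {x} νx = ≼-sandwich (≼-neg (val⇒≼ νx))
    λ h → val-≰ νx (≼-cong (solve 1 (λ x → :- (:- x) := x) refl x) (≼-neg h))

  val-⁻¹ : ∀ {x n} → Val x n → Val (x ⁻¹) (ℤ.- n)
  val-⁻¹ {x} {n} νx with val? (x ⁻¹)
  ... | inj₁ x⁻¹≈0 = contradiction (trans (sym (inverseʳ (val⇒≉0 νx))) (trans (*-congˡ x⁻¹≈0) (zeroʳ x))) 1≉0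
  ... | inj₂ (m , νx⁻¹) = ≡.trans νx⁻¹ (≡.cong [_] (ℤ-+.inverseʳ-unique n m n+m≡0))
    where
    n+m≡0 : n ℤ.+ m ≡ + 0
    n+m≡0 = val-unique (val-cong (inverseʳ (val⇒≉0 νx)) (val-* νx νx⁻¹)) val-1

  ≉0-* : ∀ {x y} → x ≉ 0# → y ≉ 0# → x * y ≉ 0#
  ≉0-* x≉0 y≉0 = val⇒≉0 (val-* (proj₂ (≉0⇒val x≉0)) (proj₂ (≉0⇒val y≉0)))

  inverseˡ : ∀ {x} → x ≉ 0# → x ⁻¹ * x ≈ 1#
  inverseˡ x≉0 = trans (*-comm _ _) (inverseʳ x≉0)

  val-^ : ∀ {x v} → Val x v → ∀ n → Val (x ^ n) (+ n ℤ.* v)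
  val-^ νx ℕ.zero    = val-1
  val-^ {v = v} νx (ℕ.suc n) = ≡.trans (val-* νx (val-^ νx n)) (≡.cong [_] (≡.sym (ℤ.suc-* (+ n) v)))

  val-^ᶻ : ∀ {x} → Val x (+ 1) → ∀ n → Val (x ^ᶻ n) n
  val-^ᶻ νx (+ n)    = ≡.trans (val-^ νx n) (≡.cong [_] (ℤ.*-identityʳ (+ n)))
  val-^ᶻ νx -[1+ n ] = val-⁻¹ (≡.trans (val-^ νx (ℕ.suc n)) (≡.cong [_] (ℤ.*-identityʳ (+ ℕ.suc n))))

  *-cancelʳ-≉0 : ∀ {x y z} → z ≉ 0# → x * z ≈ y * z → x ≈ y
  *-cancelʳ-≉0 {x} {y} {z} z≉0 eq = begin
    x             ≈⟨ *-identityʳ x ⟨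
    x * 1#        ≈⟨ *-congˡ (inverseʳ z≉0) ⟨
    x * (z * z ⁻¹) ≈⟨ *-assoc x z (z ⁻¹) ⟨
    x * z * z ⁻¹  ≈⟨ *-congʳ eq ⟩
    y * z * z ⁻¹  ≈⟨ *-assoc y z (z ⁻¹) ⟩
    y * (z * z ⁻¹) ≈⟨ *-congˡ (inverseʳ z≉0) ⟩
    y * 1#        ≈⟨ *-identityʳ y ⟩
    y             ∎

  -- Carries the condition `bound` over to a perturbed N z of the same valuation.
  ≼-*-transfer : ∀ {v x y n} z → Val x n → Val y n → v ≼ x * z → v ≼ y * z
  ≼-*-transfer z νx νy h with val? z
  ... | inj₁ z≈0      = ≼-cong (sym (trans (*-congˡ z≈0) (zeroʳ _))) ≼-0
  ... | inj₂ (_ , νz) = ≼-weaken (val-≤ (val-* νx νz) h) (val⇒≼ (val-* νy νz))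

-- Absolute values as rational powers, and the valuation of 2.

/-≤⇒*-≤* : ∀ i m .{{_ : ℕ.NonZero m}} j n .{{_ : ℕ.NonZero n}} → i ℚ./ m ℚ.≤ j ℚ./ n → i ℤ.* + n ℤ.≤ j ℤ.* + m
/-≤⇒*-≤* i (ℕ.suc m) j (ℕ.suc n) h = ℚᵘ.drop-*≤* (ℚᵘ.≤-trans (ℚᵘ.≤-reflexive (ℚᵘ.≃-sym (ℚ.toℚᵘ-fromℚᵘ (mkℚᵘ i m))))
  (ℚᵘ.≤-trans (ℚ.toℚᵘ-mono-≤ h) (ℚᵘ.≤-reflexive (ℚ.toℚᵘ-fromℚᵘ (mkℚᵘ j n)))))

*-≤*⇒/-≤ : ∀ i m .{{_ : ℕ.NonZero m}} j n .{{_ : ℕ.NonZero n}} → i ℤ.* + n ℤ.≤ j ℤ.* + m → i ℚ./ m ℚ.≤ j ℚ./ n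
*-≤*⇒/-≤ i (ℕ.suc m) j (ℕ.suc n) h = ℚ.toℚᵘ-cancel-≤ (ℚᵘ.≤-trans (ℚᵘ.≤-reflexive (ℚ.toℚᵘ-fromℚᵘ (mkℚᵘ i m)))
  (ℚᵘ.≤-trans (ℚᵘ.*≤* h) (ℚᵘ.≤-reflexive (ℚᵘ.≃-sym (ℚ.toℚᵘ-fromℚᵘ (mkℚᵘ j n))))))

module _ (b : ℕ) .{{_ : ℕ.NonZero b}} (1<b : 1 ℕ.< b) where

  ^-cancelˡ-≤ : ∀ {m n} → b ℕ.^ m ℕ.≤ b ℕ.^ n → m ℕ.≤ n
  ^-cancelˡ-≤ {m} {n} h with m ℕ.≤? n
  ... | yes m≤n = m≤n
  ... | no  m≰n = contradiction h (ℕ.<⇒≱ (ℕ.^-monoʳ-< b 1<b (ℕ.≰⇒> m≰n)))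

  ^--cancel-≤ : ∀ m n → b ^- [ m ] ℚ.≤ b ^- [ n ] → n ℤ.≤ m
  ^--cancel-≤ (+ m) (+ n) h = ℤ.+≤+ (^-cancelˡ-≤ (ℤ.drop‿+≤+ (≡.subst₂ ℤ._≤_ (ℤ.*-identityˡ _) (ℤ.*-identityˡ _)
    (/-≤⇒*-≤* (+ 1) (b ℕ.^ m) {{ℕ.m^n≢0 b m}} (+ 1) (b ℕ.^ n) {{ℕ.m^n≢0 b n}} h))))
  ^--cancel-≤ (+ m) -[1+ n ] h = ℤ.-≤+
  ^--cancel-≤ -[1+ m ] (+ n) h = contradiction b^[1+m+n]≤1 (ℕ.<⇒≱ (ℕ.^-monoʳ-< b 1<b (ℕ.s≤s (ℕ.z≤n {m ℕ.+ n}))))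
    where
    b^[1+m+n]≤1 : b ℕ.^ (ℕ.suc m ℕ.+ n) ℕ.≤ 1
    b^[1+m+n]≤1 = ≡.subst (ℕ._≤ 1) (≡.sym (ℕ.^-distribˡ-+-* b (ℕ.suc m) n)) (ℤ.drop‿+≤+
      (≡.subst (ℤ._≤ + 1) (≡.sym (ℤ.pos-* (b ℕ.^ ℕ.suc m) (b ℕ.^ n)))
        (/-≤⇒*-≤* (+ (b ℕ.^ ℕ.suc m)) 1 (+ 1) (b ℕ.^ n) {{ℕ.m^n≢0 b n}} h)))
  ^--cancel-≤ -[1+ m ] -[1+ n ] h = ℤ.-≤- (ℕ.s≤s⁻¹ (^-cancelˡ-≤ (ℤ.drop‿+≤+ (≡.subst₂ ℤ._≤_ (ℤ.*-identityʳ _) (ℤ.*-identityʳ _)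
    (/-≤⇒*-≤* (+ (b ℕ.^ ℕ.suc m)) 1 (+ (b ℕ.^ ℕ.suc n)) 1 h)))))

  ^-≤1⇒0≤ : ∀ x → b ^- x ℚ.≤ 1ℚ → [ + 0 ] ≤⁺ x
  ^-≤1⇒0≤ [ n ] h = [ ^--cancel-≤ n (+ 0) h ]
  ^-≤1⇒0≤ ⊤⁺    h = [ + 0 ] ≤⊤⁺

  0≤⇒^-≤1 : ∀ x → [ + 0 ] ≤⁺ x → b ^- x ℚ.≤ 1ℚ
  0≤⇒^-≤1 [ + n ] h = *-≤*⇒/-≤ (+ 1) (b ℕ.^ n) {{ℕ.m^n≢0 b n}} (+ 1) 1
    (≡.subst (+ 1 ℤ.≤_) (≡.sym (ℤ.*-identityˡ _)) (ℤ.+≤+ (ℕ.m^n>0 b n)))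
  0≤⇒^-≤1 [ -[1+ n ] ] [ () ]
  0≤⇒^-≤1 ⊤⁺ h = ℚ.nonNegative⁻¹ 1ℚ

module AbsoluteValue {c ℓ} (k : DyadicLocalField c ℓ) where

  open DyadicLocalField k
  open ValuationProperties k
  open IntegerCoefficients commutativeRing

  -- 0 and 1 lie in different residue classes. With base 1 every nonzero element would have absolute
  -- value 1, and the valuation could not be recovered.
  1<residueCardinality : 1 ℕ.< residueCardinality
  1<residueCardinality = at-least-two residueField
    where
    at-least-two : (R : Representatives 𝔭) → 1 ℕ.< Representatives.size R
    at-least-two record { size = 0 ; covers = covers } with () ← proj₁ (covers 0# ≼-0)
    at-least-two record { size = 1 ; rep = rep ; covers = covers } with covers 0# ≼-0 | covers 1# (val⇒≼ val-1)
    ... | Fin.zero , h | Fin.zero , h′ = contradiction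
      (≼-cong (solve 1 (λ y → (con (+ 1) :- y) :- (con (+ 0) :- y) := con (+ 1)) refl (rep Fin.zero)) (≼-- h′ h)) (val-≰ val-1)
    at-least-two record { size = ℕ.suc (ℕ.suc n) } = ℕ.s≤s (ℕ.s≤s ℕ.z≤n)

  ∣∣≤⇒val≤ : ∀ {x y m n} → Val x m → Val y n → ∣ x ∣ₖ ℚ.≤ ∣ y ∣ₖ → n ℤ.≤ m
  ∣∣≤⇒val≤ {m = m} {n} νx νy h = ^--cancel-≤ residueCardinality {{residueCardinality-nonZero}} 1<residueCardinality m n
    (≡.subst₂ ℚ._≤_ (≡.cong (_^-_ residueCardinality {{residueCardinality-nonZero}}) νx)
      (≡.cong (_^-_ residueCardinality {{residueCardinality-nonZero}}) νy) h)

  ∣∣≤1⇒integral : ∀ x → ∣ x ∣ₖ ℚ.≤ 1ℚ → + 0 ≼ x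
  ∣∣≤1⇒integral x = ^-≤1⇒0≤ residueCardinality {{residueCardinality-nonZero}} 1<residueCardinality (νₖ x)

  integral⇒∣∣≤1 : ∀ x → + 0 ≼ x → ∣ x ∣ₖ ℚ.≤ 1ℚ
  integral⇒∣∣≤1 x = 0≤⇒^-≤1 residueCardinality {{residueCardinality-nonZero}} 1<residueCardinality (νₖ x)

  ramification⇒val-2 : ∀ {π e} → IsUniformizer π → IsRamificationIndex π e → Val 2# (+ e)
  ramification⇒val-2 {π} {e} νπ (2⊆πᵉ , πᵉ⊆2)
    with y , 0≼y , 2≈πᵉy ← 2⊆πᵉ (1# , val⇒≼ val-1 , sym (*-identityʳ 2#))
       | y′ , 0≼y′ , πᵉ≈2y′ ← πᵉ⊆2 (1# , val⇒≼ val-1 , sym (*-identityʳ (π ^ e))) =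
    ≼-sandwich (≡.subst (_≼ 2#) (ℤ.+-identityʳ (+ e)) (≼-cong (sym 2≈πᵉy) (≼-* (val⇒≼ (val-^ᶻ νπ (+ e))) 0≼y)))
      λ h → val-≰ (val-^ᶻ νπ (+ e)) (≡.subst (_≼ π ^ e) (ℤ.+-identityʳ (+ 1 ℤ.+ + e)) (≼-cong (sym πᵉ≈2y′) (≼-* h 0≼y′)))

-- The local square theorem.

module LocalSquares {c ℓ} (k : DyadicLocalField c ℓ) where

  open DyadicLocalField k
  open ValuationProperties k
  open IntegerCoefficients commutativeRing

  module _ (ε : Carrier) (ε∈𝔭 : ε ∈ 𝔭) where

    -- y ↦ ε - y² maps 𝔭 to itself and raises the valuation of differences.
    iterate : ℕ → Carrier
    iterate ℕ.zero    = 0#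
    iterate (ℕ.suc n) = ε - iterate n * iterate n

    iterate∈𝔭 : ∀ n → + 1 ≼ iterate n
    iterate∈𝔭 ℕ.zero    = ≼-0
    iterate∈𝔭 (ℕ.suc n) = ≼-- ε∈𝔭 (≼-weaken {v = + 2} (ℤ.+≤+ (ℕ.s≤s ℕ.z≤n)) (≼-* (iterate∈𝔭 n) (iterate∈𝔭 n)))

    iterate-step : ∀ n → + n ≼ iterate (ℕ.suc n) - iterate n
    iterate-step ℕ.zero    = ≼-weaken {v = + 1} (ℤ.+≤+ ℕ.z≤n) (≼-- (iterate∈𝔭 1) ≼-0)
    iterate-step (ℕ.suc n) = ≼-cong
      (solve 3 (λ ε x y → :- ((y :+ x) :* (y :- x)) := (ε :- y :* y) :- (ε :- x :* x)) refl ε (iterate n) (iterate (ℕ.suc n)))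
      (≼-neg (≼-* (≼-+ (iterate∈𝔭 (ℕ.suc n)) (iterate∈𝔭 n)) (iterate-step n)))

    iterate-close : ∀ m j → + m ≼ iterate (j ℕ.+ m) - iterate m
    iterate-close m ℕ.zero    = ≼-cong (sym (-‿inverseʳ (iterate m))) ≼-0
    iterate-close m (ℕ.suc j) = ≼-cong
      (solve 3 (λ x y z → (z :- y) :+ (y :- x) := z :- x) refl (iterate m) (iterate (j ℕ.+ m)) (iterate (ℕ.suc j ℕ.+ m)))
      (≼-+ (≼-weaken (ℤ.+≤+ (ℕ.m≤n+m m j)) (iterate-step (j ℕ.+ m))) (iterate-close m j))

    iterate-close-≤ : ∀ {M m} → M ℕ.≤ m → + M ≼ iterate m - iterate M
    iterate-close-≤ {M} {m} M≤m =
      ≡.subst (λ i → + M ≼ iterate i - iterate M) (ℕ.m∸n+n≡m M≤m) (iterate-close M (m ℕ.∸ M))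

    iterate-cauchy : Cauchy iterate
    iterate-cauchy b = ℤ.∣ b ∣ , λ m n M≤m M≤n → ≼-weaken (i≤+∣i∣ b) (≼-cong
      (solve 3 (λ x y z → (x :- z) :- (y :- z) := x :- y) refl (iterate m) (iterate n) (iterate ℤ.∣ b ∣))
      (≼-- (iterate-close-≤ M≤m) (iterate-close-≤ M≤n)))

    -- As (1 + 2y)² = 1 + 4(y + y²), this is extraction of a square root with the factor 4 divided
    -- out. The derivative 1 + 2y is a unit, unlike that of y², so a contraction finds the root.
    artin-schreier-root : ∃[ y ] y ∈ 𝔭 × y + y * y ≈ ε
    artin-schreier-root with y , y-limit ← complete iterate iterate-cauchy = y , y∈𝔭 , y+y²≈ε
      where
      y∈𝔭 : + 1 ≼ y
      y∈𝔭 with M , h ← y-limit (+ 1) = ≼-cong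
        (solve 2 (λ x y → x :- (x :- y) := y) refl (iterate M) y)
        (≼-- (iterate∈𝔭 M) (h M ℕ.≤-refl))

      -- The error is expressed through the distances of two consecutive iterates from the limit y.
      residue-small : ∀ v → v ≼ y + y * y - ε
      residue-small v with M , h ← y-limit v = ≼-cong
        (solve 3 (λ ε x y → :- ((ε :- x :* x) :- y) :- ((x :- y) :* (x :+ y)) := y :+ y :* y :- ε) refl ε (iterate M) y)
        (≼-- (≼-neg (h (ℕ.suc M) (ℕ.n≤1+n M)))
             (≼-weaken v≤v+1 (≼-* (h M ℕ.≤-refl) (≼-+ (iterate∈𝔭 M) y∈𝔭))))
        where
        v≤v+1 : v ℤ.≤ v ℤ.+ + 1
        v≤v+1 = ≤-by-difference {+ 0} {+ 1} (ℤ.+≤+ ℕ.z≤n) (ℤ-solve (v ∷ []))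

      y+y²≈ε : y + y * y ≈ ε
      y+y²≈ε = trans (solve 2 (λ ε x → x := ε :+ (x :- ε)) refl ε (y + y * y))
                (trans (+-congˡ (∀≼⇒≈0 residue-small)) (+-identityʳ ε))

  module _ {e : ℤ} (ν2 : Val 2# e) where

    1≤e : + 1 ℤ.≤ e
    1≤e = val-≤ ν2 residueChar2

    val-4 : Val 4# (e ℤ.+ e)
    val-4 = val-* ν2 ν2

    val-1+2y : ∀ {y} → + 0 ≼ y → Val (1# + 2# * y) (+ 0)
    val-1+2y 0≼y = val-+ val-1 (≼-weaken {v = e ℤ.+ + 0} (ℤ.+-mono-≤ 1≤e ℤ.≤-refl) (≼-* (val⇒≼ ν2) 0≼y))

    -- Here y = x (1 + 4ε) with ε in 𝔭, and 1 + 4ε = (1 + 2t)² for the root t of t + t² = ε.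
    local-square-theorem : ∀ {x y n} → Val x n → + 1 ℤ.+ (n ℤ.+ (e ℤ.+ e)) ≼ y - x →
                           ∃[ c ] c ≉ 0# × y ≈ x * (c * c)
    local-square-theorem {x} {y} {n} νx h = 1# + 2# * t , val⇒≉0 (val-1+2y (≼-weaken (ℤ.+≤+ ℕ.z≤n) t∈𝔭)) , y≈xc²
      where
      ν4x : Val (4# * x) (n ℤ.+ (e ℤ.+ e))
      ν4x = val-cong (*-comm x 4#) (val-* νx val-4)

      4x≉0 : 4# * x ≉ 0#
      4x≉0 = val⇒≉0 ν4x

      ε : Carrier
      ε = (y - x) * (4# * x) ⁻¹

      ε4x≈y-x : ε * (4# * x) ≈ y - x
      ε4x≈y-x = trans (*-assoc _ _ _) (trans (*-congˡ (inverseˡ 4x≉0)) (*-identityʳ _))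

      ε∈𝔭 : + 1 ≼ ε
      ε∈𝔭 = ≼-cancelʳ ν4x (≼-cong (sym ε4x≈y-x) h)

      root : ∃[ t ] t ∈ 𝔭 × t + t * t ≈ ε
      root = artin-schreier-root ε ε∈𝔭
      t : Carrier
      t = proj₁ root
      t∈𝔭 : t ∈ 𝔭
      t∈𝔭 = proj₁ (proj₂ root)

      open import Relation.Binary.Reasoning.Setoid setoid

      y≈xc² : y ≈ x * ((1# + 2# * t) * (1# + 2# * t))
      y≈xc² = begin
        y                                      ≈⟨ solve 2 (λ x y → y := x :+ (y :- x)) refl x y ⟩
        x + (y - x)                            ≈⟨ +-congˡ ε4x≈y-x ⟨
        x + ε * (4# * x)                       ≈⟨ +-congˡ (*-congʳ (proj₂ (proj₂ root))) ⟨
        x + (t + t * t) * (4# * x)             ≈⟨ solve 2 (λ x t →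
                                                    x :+ (t :+ t :* t) :* ((twoₚ :* twoₚ) :* x) :=
                                                    x :* ((oneₚ :+ twoₚ :* t) :* (oneₚ :+ twoₚ :* t))) refl x t ⟩
        x * ((1# + 2# * t) * (1# + 2# * t))    ∎

  -- If Δ = x², the expression Δ = x² + 0 confines the defect to the zero ideal.
  nonzeroDefect⇒nonsquare : ∀ {Δ} → NonzeroIdeal (𝔡 Δ) → ∀ x → ¬ (Δ ≈ x * x)
  nonzeroDefect⇒nonsquare (y , y∈𝔡 , y≉0) x Δ≈x² with a , _ , y≈0a ← y∈𝔡 x 0# (trans Δ≈x² (sym (+-identityʳ _))) =
    y≉0 (trans y≈0a (zeroˡ a))

-- Identities for the reduced norm and its polar form.

module QuaternionIdentities {c ℓ} (k : DyadicLocalField c ℓ) (π Δ : DyadicLocalField.Carrier k) where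

  open DyadicLocalField k
  open QuaternionAlgebra k π Δ
  open IntegerCoefficients commutativeRing
  open import Relation.Binary.Reasoning.Setoid setoid

  ≈ᴰ-refl : ∀ {p} → p ≈ᴰ p
  ≈ᴰ-refl = refl , refl , refl , refl

  -ᴰ-cong : ∀ {p p′ q q′} → p ≈ᴰ p′ → q ≈ᴰ q′ → p -ᴰ q ≈ᴰ p′ -ᴰ q′
  -ᴰ-cong (p₀ , p₁ , p₂ , p₃) (q₀ , q₁ , q₂ , q₃) =
    +-cong p₀ (-‿cong q₀) , +-cong p₁ (-‿cong q₁) , +-cong p₂ (-‿cong q₂) , +-cong p₃ (-‿cong q₃)

  conj-cong : ∀ {p p′} → p ≈ᴰ p′ → conj p ≈ᴰ conj p′
  conj-cong (p₀ , p₁ , p₂ , p₃) = p₀ , -‿cong p₁ , -‿cong p₂ , -‿cong p₃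

  *ᴰ-cong : ∀ {p p′ q q′} → p ≈ᴰ p′ → q ≈ᴰ q′ → p *ᴰ q ≈ᴰ p′ *ᴰ q′
  *ᴰ-cong (p₀ , p₁ , p₂ , p₃) (q₀ , q₁ , q₂ , q₃) =
    +-cong (+-cong (+-cong (*-cong p₀ q₀) (*-congˡ (*-cong p₁ q₁))) (*-congˡ (*-cong p₂ q₂))) (-‿cong (*-congˡ (*-cong p₃ q₃))) ,
    +-cong (+-cong (+-cong (*-cong p₀ q₁) (*-cong p₁ q₀)) (*-congˡ (*-cong p₃ q₂))) (-‿cong (*-congˡ (*-cong p₂ q₃))) ,
    +-cong (+-cong (+-cong (*-cong p₀ q₂) (*-cong p₂ q₀)) (*-congˡ (*-cong p₁ q₃))) (-‿cong (*-congˡ (*-cong p₃ q₁))) ,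
    +-cong (+-cong (+-cong (*-cong p₀ q₃) (*-cong p₃ q₀)) (*-cong p₁ q₂)) (-‿cong (*-cong p₂ q₁))

  N-cong : ∀ {p p′} → p ≈ᴰ p′ → N p ≈ N p′
  N-cong p≈p′ = proj₁ (*ᴰ-cong p≈p′ (conj-cong p≈p′))

  -- The literal `0#` shows purity to the solver; `IsPure` gives it only up to `≈`, a gap that
  -- `KStar-cong` bridges.
  imag : Carrier → Carrier → Carrier → D
  imag b₁ b₂ b₃ = quat 0# b₁ b₂ b₃

  -- The polar form of N, that is, the reduced trace of p q̄.
  T : D → D → Carrier
  T p q = 2# * x₀ (p *ᴰ conj q)

  -- Symbolic quaternions, so that the ring solver sees the expansions of the operations of D.
  record Quatₚ (n : ℕ) : Set where
    constructor quatₚ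
    field
      y₀ y₁ y₂ y₃ : Polynomial n
  open Quatₚ

  infixl 6 _⊕_ _⊖_
  _⊕_ _⊖_ : ∀ {n} → Quatₚ n → Quatₚ n → Quatₚ n
  quatₚ a₀ a₁ a₂ a₃ ⊕ quatₚ b₀ b₁ b₂ b₃ = quatₚ (a₀ :+ b₀) (a₁ :+ b₁) (a₂ :+ b₂) (a₃ :+ b₃)
  quatₚ a₀ a₁ a₂ a₃ ⊖ quatₚ b₀ b₁ b₂ b₃ = quatₚ (a₀ :- b₀) (a₁ :- b₁) (a₂ :- b₂) (a₃ :- b₃)

  conjₚ : ∀ {n} → Quatₚ n → Quatₚ n
  conjₚ (quatₚ a₀ a₁ a₂ a₃) = quatₚ a₀ (:- a₁) (:- a₂) (:- a₃)

  module _ {n} (πₚ Δₚ : Polynomial n) where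

    mulₚ : Quatₚ n → Quatₚ n → Quatₚ n
    mulₚ (quatₚ a₀ a₁ a₂ a₃) (quatₚ b₀ b₁ b₂ b₃) = quatₚ
      (a₀ :* b₀ :+ πₚ :* (a₁ :* b₁) :+ Δₚ :* (a₂ :* b₂) :- (πₚ :* Δₚ) :* (a₃ :* b₃))
      (a₀ :* b₁ :+ a₁ :* b₀ :+ Δₚ :* (a₃ :* b₂) :- Δₚ :* (a₂ :* b₃))
      (a₀ :* b₂ :+ a₂ :* b₀ :+ πₚ :* (a₁ :* b₃) :- πₚ :* (a₃ :* b₁))
      (a₀ :* b₃ :+ a₃ :* b₀ :+ a₁ :* b₂ :- a₂ :* b₁)

    normₚ : Quatₚ n → Polynomial n
    normₚ q = y₀ (mulₚ q (conjₚ q))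

    polarₚ : Quatₚ n → Quatₚ n → Polynomial n
    polarₚ p q = twoₚ :* y₀ (mulₚ p (conjₚ q))

    sandwichₚ : Quatₚ n → Quatₚ n → Quatₚ n → Quatₚ n
    sandwichₚ p a q = mulₚ (mulₚ p a) (conjₚ q)

  N-* : ∀ p q → N (p *ᴰ q) ≈ N p * N q
  N-* (quat a₀ a₁ a₂ a₃) (quat b₀ b₁ b₂ b₃) = solve 10 (λ π Δ a₀ a₁ a₂ a₃ b₀ b₁ b₂ b₃ →
    let p = quatₚ a₀ a₁ a₂ a₃ ; q = quatₚ b₀ b₁ b₂ b₃ in
    normₚ π Δ (mulₚ π Δ p q) := normₚ π Δ p :* normₚ π Δ q) refl π Δ a₀ a₁ a₂ a₃ b₀ b₁ b₂ b₃

  N-conj : ∀ q → N (conj q) ≈ N q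
  N-conj (quat a₀ a₁ a₂ a₃) = solve 6 (λ π Δ a₀ a₁ a₂ a₃ →
    let q = quatₚ a₀ a₁ a₂ a₃ in normₚ π Δ (conjₚ q) := normₚ π Δ q) refl π Δ a₀ a₁ a₂ a₃

  N-+ : ∀ p q → N (p +ᴰ q) ≈ N p + T p q + N q
  N-+ (quat a₀ a₁ a₂ a₃) (quat b₀ b₁ b₂ b₃) = solve 10 (λ π Δ a₀ a₁ a₂ a₃ b₀ b₁ b₂ b₃ →
    let p = quatₚ a₀ a₁ a₂ a₃ ; q = quatₚ b₀ b₁ b₂ b₃ in
    normₚ π Δ (p ⊕ q) := normₚ π Δ p :+ polarₚ π Δ p q :+ normₚ π Δ q) refl π Δ a₀ a₁ a₂ a₃ b₀ b₁ b₂ b₃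

  N-- : ∀ p q → N (p -ᴰ q) ≈ N p - T p q + N q
  N-- (quat a₀ a₁ a₂ a₃) (quat b₀ b₁ b₂ b₃) = solve 10 (λ π Δ a₀ a₁ a₂ a₃ b₀ b₁ b₂ b₃ →
    let p = quatₚ a₀ a₁ a₂ a₃ ; q = quatₚ b₀ b₁ b₂ b₃ in
    normₚ π Δ (p ⊖ q) := normₚ π Δ p :- polarₚ π Δ p q :+ normₚ π Δ q) refl π Δ a₀ a₁ a₂ a₃ b₀ b₁ b₂ b₃

  N-ι : ∀ x → N (ι x) ≈ x * x
  N-ι x = solve 3 (λ π Δ x → normₚ π Δ (quatₚ x zeroₚ zeroₚ zeroₚ) := x :* x) refl π Δ x

  N-1- : ∀ r → N (1ᴰ -ᴰ r) ≈ N r + 1# - 2# * x₀ r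
  N-1- (quat a₀ a₁ a₂ a₃) = solve 6 (λ π Δ a₀ a₁ a₂ a₃ →
    let q = quatₚ a₀ a₁ a₂ a₃ in
    normₚ π Δ (quatₚ oneₚ zeroₚ zeroₚ zeroₚ ⊖ q) := normₚ π Δ q :+ oneₚ :- twoₚ :* a₀) refl π Δ a₀ a₁ a₂ a₃

  x₀-sandwich-imag : ∀ r b₁ b₂ b₃ → x₀ (r *ᴰ imag b₁ b₂ b₃ *ᴰ conj r) ≈ 0#
  x₀-sandwich-imag (quat a₀ a₁ a₂ a₃) b₁ b₂ b₃ = solve 9 (λ π Δ a₀ a₁ a₂ a₃ b₁ b₂ b₃ →
    let r = quatₚ a₀ a₁ a₂ a₃ in
    y₀ (sandwichₚ π Δ r (quatₚ zeroₚ b₁ b₂ b₃) r) := zeroₚ) refl π Δ a₀ a₁ a₂ a₃ b₁ b₂ b₃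

  T-imag-sandwich : ∀ r b₁ b₂ b₃ → let a = imag b₁ b₂ b₃ ; b = x₀ (r *ᴰ conj a) in
    T a (r *ᴰ a *ᴰ conj r) ≈ 2# * ((x₀ r * x₀ r - (N r - x₀ r * x₀ r)) * N a + 2# * (b * b))
  T-imag-sandwich (quat a₀ a₁ a₂ a₃) b₁ b₂ b₃ = solve 9 (λ π Δ a₀ a₁ a₂ a₃ b₁ b₂ b₃ →
    let r = quatₚ a₀ a₁ a₂ a₃ ; a = quatₚ zeroₚ b₁ b₂ b₃ ; b = y₀ (mulₚ π Δ r (conjₚ a)) in
    polarₚ π Δ a (sandwichₚ π Δ r a r) :=
    twoₚ :* ((a₀ :* a₀ :- (normₚ π Δ r :- a₀ :* a₀)) :* normₚ π Δ a :+ twoₚ :* (b :* b)))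
    refl π Δ a₀ a₁ a₂ a₃ b₁ b₂ b₃

  N-sandwich : ∀ p a q → N (p *ᴰ a *ᴰ conj q) ≈ N p * N a * N q
  N-sandwich p a q = trans (N-* (p *ᴰ a) (conj q)) (*-cong (N-* p a) (N-conj q))

  -- The last bracket is the Gram determinant of a and the pure part of r. Divided by N a, it is the
  -- norm of the component of r orthogonal to k(a).
  N-a-rar̄ : ∀ r b₁ b₂ b₃ → let a = imag b₁ b₂ b₃ ; b = x₀ (r *ᴰ conj a) in
    N (a -ᴰ r *ᴰ a *ᴰ conj r) ≈ N a * ((N r - 1#) * (N r - 1#)) + 4# * ((N r - x₀ r * x₀ r) * N a - b * b)
  N-a-rar̄ r b₁ b₂ b₃ = begin
    N (a -ᴰ r *ᴰ a *ᴰ conj r)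
      ≈⟨ N-- a (r *ᴰ a *ᴰ conj r) ⟩
    N a - T a (r *ᴰ a *ᴰ conj r) + N (r *ᴰ a *ᴰ conj r)
      ≈⟨ +-cong (+-congˡ (-‿cong (T-imag-sandwich r b₁ b₂ b₃))) (N-sandwich r a r) ⟩
    N a - 2# * ((x₀ r * x₀ r - (N r - x₀ r * x₀ r)) * N a + 2# * (b * b)) + N r * N a * N r
      ≈⟨ solve 4 (λ A m r b → A :- twoₚ :* ((r :* r :- (m :- r :* r)) :* A :+ twoₚ :* (b :* b)) :+ m :* A :* m :=
            A :* ((m :- oneₚ) :* (m :- oneₚ)) :+ fourₚ :* ((m :- r :* r) :* A :- b :* b)) refl (N a) (N r) (x₀ r) b ⟩
    N a * ((N r - 1#) * (N r - 1#)) + 4# * ((N r - x₀ r * x₀ r) * N a - b * b) ∎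
    where
    a : D
    a = imag b₁ b₂ b₃
    b : Carrier
    b = x₀ (r *ᴰ conj a)

  -- When l a is the orthogonal projection of the pure part of r to the line of a, the bracket is
  -- the norm of the component of r orthogonal to k(a).
  N-shifted-imag : ∀ r b₁ b₂ b₃ x l → let a = imag b₁ b₂ b₃ in
    N (quat x (2# * (x₁ r - l * b₁)) (2# * (x₂ r - l * b₂)) (2# * (x₃ r - l * b₃))) ≈
    x * x + 4# * ((N r - x₀ r * x₀ r) - 2# * l * x₀ (r *ᴰ conj a) + l * l * N a)
  N-shifted-imag (quat a₀ a₁ a₂ a₃) b₁ b₂ b₃ x l = solve 11 (λ π Δ a₀ a₁ a₂ a₃ b₁ b₂ b₃ x l →
    let r = quatₚ a₀ a₁ a₂ a₃ ; a = quatₚ zeroₚ b₁ b₂ b₃ in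
    normₚ π Δ (quatₚ x (twoₚ :* (a₁ :- l :* b₁)) (twoₚ :* (a₂ :- l :* b₂)) (twoₚ :* (a₃ :- l :* b₃))) :=
    x :* x :+ fourₚ :* ((normₚ π Δ r :- a₀ :* a₀) :- twoₚ :* l :* y₀ (mulₚ π Δ r (conjₚ a)) :+ l :* l :* normₚ π Δ a))
    refl π Δ a₀ a₁ a₂ a₃ b₁ b₂ b₃ x l

  -- For pure a the conjugate of x = h a r̄ is -r a h̄. The two cross terms in the expansion with s
  -- = r + h therefore add up to x - x̄.
  sandwich-perturb : ∀ r s b₁ b₂ b₃ → let a = imag b₁ b₂ b₃ ; h = s -ᴰ r ; x = h *ᴰ a *ᴰ conj r in
    a -ᴰ s *ᴰ a *ᴰ conj s ≈ᴰ (a -ᴰ r *ᴰ a *ᴰ conj r) -ᴰ ((x -ᴰ conj x) +ᴰ h *ᴰ a *ᴰ conj h)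
  sandwich-perturb (quat a₀ a₁ a₂ a₃) (quat s₀ s₁ s₂ s₃) b₁ b₂ b₃ =
    solve 13 (λ π Δ a₀ a₁ a₂ a₃ s₀ s₁ s₂ s₃ b₁ b₂ b₃ → y₀ (lhs π Δ a₀ a₁ a₂ a₃ s₀ s₁ s₂ s₃ b₁ b₂ b₃) := y₀ (rhs π Δ a₀ a₁ a₂ a₃ s₀ s₁ s₂ s₃ b₁ b₂ b₃))
      refl π Δ a₀ a₁ a₂ a₃ s₀ s₁ s₂ s₃ b₁ b₂ b₃ ,
    solve 13 (λ π Δ a₀ a₁ a₂ a₃ s₀ s₁ s₂ s₃ b₁ b₂ b₃ → y₁ (lhs π Δ a₀ a₁ a₂ a₃ s₀ s₁ s₂ s₃ b₁ b₂ b₃) := y₁ (rhs π Δ a₀ a₁ a₂ a₃ s₀ s₁ s₂ s₃ b₁ b₂ b₃))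
      refl π Δ a₀ a₁ a₂ a₃ s₀ s₁ s₂ s₃ b₁ b₂ b₃ ,
    solve 13 (λ π Δ a₀ a₁ a₂ a₃ s₀ s₁ s₂ s₃ b₁ b₂ b₃ → y₂ (lhs π Δ a₀ a₁ a₂ a₃ s₀ s₁ s₂ s₃ b₁ b₂ b₃) := y₂ (rhs π Δ a₀ a₁ a₂ a₃ s₀ s₁ s₂ s₃ b₁ b₂ b₃))
      refl π Δ a₀ a₁ a₂ a₃ s₀ s₁ s₂ s₃ b₁ b₂ b₃ ,
    solve 13 (λ π Δ a₀ a₁ a₂ a₃ s₀ s₁ s₂ s₃ b₁ b₂ b₃ → y₃ (lhs π Δ a₀ a₁ a₂ a₃ s₀ s₁ s₂ s₃ b₁ b₂ b₃) := y₃ (rhs π Δ a₀ a₁ a₂ a₃ s₀ s₁ s₂ s₃ b₁ b₂ b₃))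
      refl π Δ a₀ a₁ a₂ a₃ s₀ s₁ s₂ s₃ b₁ b₂ b₃
    where
    lhs rhs : ∀ {n} (π Δ a₀ a₁ a₂ a₃ s₀ s₁ s₂ s₃ b₁ b₂ b₃ : Polynomial n) → Quatₚ n
    lhs π Δ a₀ a₁ a₂ a₃ s₀ s₁ s₂ s₃ b₁ b₂ b₃ =
      let a = quatₚ zeroₚ b₁ b₂ b₃ ; s = quatₚ s₀ s₁ s₂ s₃ in a ⊖ sandwichₚ π Δ s a s
    rhs π Δ a₀ a₁ a₂ a₃ s₀ s₁ s₂ s₃ b₁ b₂ b₃ =
      let a = quatₚ zeroₚ b₁ b₂ b₃ ; s = quatₚ s₀ s₁ s₂ s₃ ; r = quatₚ a₀ a₁ a₂ a₃ ; h = s ⊖ r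
          x = sandwichₚ π Δ h a r in
      (a ⊖ sandwichₚ π Δ r a r) ⊖ ((x ⊖ conjₚ x) ⊕ sandwichₚ π Δ h a h)

  T-congˡ : ∀ {p p′} q → p ≈ᴰ p′ → T p q ≈ T p′ q
  T-congˡ q p≈p′ = *-congˡ (proj₁ (*ᴰ-cong p≈p′ ≈ᴰ-refl))

  T-+ : ∀ p q q′ → T p (q +ᴰ q′) ≈ T p q + T p q′
  T-+ (quat a₀ a₁ a₂ a₃) (quat b₀ b₁ b₂ b₃) (quat c₀ c₁ c₂ c₃) = solve 14 (λ π Δ a₀ a₁ a₂ a₃ b₀ b₁ b₂ b₃ c₀ c₁ c₂ c₃ →
    let p = quatₚ a₀ a₁ a₂ a₃ ; q = quatₚ b₀ b₁ b₂ b₃ ; q′ = quatₚ c₀ c₁ c₂ c₃ in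
    polarₚ π Δ p (q ⊕ q′) := polarₚ π Δ p q :+ polarₚ π Δ p q′) refl π Δ a₀ a₁ a₂ a₃ b₀ b₁ b₂ b₃ c₀ c₁ c₂ c₃

  -- A pure z pairs only with the pure part, whose sign conjugation changes. The factor 2 gained
  -- here saves e in the estimate of the change of N z.
  T-imag-x-x̄ : ∀ {z} → IsPure z → ∀ x → T z (x -ᴰ conj x) ≈ 2# * T z x
  T-imag-x-x̄ {z} z₀≈0 x = trans (T-congˡ (x -ᴰ conj x) z≈) (trans
    (solve 9 (λ π Δ a₁ a₂ a₃ b₀ b₁ b₂ b₃ →
      let p = quatₚ zeroₚ a₁ a₂ a₃ ; q = quatₚ b₀ b₁ b₂ b₃ in
      polarₚ π Δ p (q ⊖ conjₚ q) := twoₚ :* polarₚ π Δ p q) refl π Δ (x₁ z) (x₂ z) (x₃ z) (x₀ x) (x₁ x) (x₂ x) (x₃ x))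
    (*-congˡ (sym (T-congˡ x z≈))))
    where
    z≈ : z ≈ᴰ imag (x₁ z) (x₂ z) (x₃ z)
    z≈ = z₀≈0 , refl , refl , refl

module Dyadic {c ℓ} (k : DyadicLocalField c ℓ) where

  open DyadicLocalField k
  open ValuationProperties k
  open LocalSquares k
  open IntegerCoefficients commutativeRing
  open import Relation.Binary.Reasoning.Setoid setoid

  -- The norm form of the unramified quadratic extension.

  module UnramifiedForm
    {e : ℤ} (ν2 : Val 2# e) (Δ δ : Carrier) (Δ-nonsquare : ∀ x → ¬ (Δ ≈ x * x)) (δ∈𝒪 : δ ∈ 𝒪) (Δ≈1+4δ : Δ ≈ 1# + 4# * δ)
    where

    -- The norm of a + bω from k(ω), as ω² = ω + δ.
    F : Carrier → Carrier → Carrier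
    F a b = a * a + a * b - δ * (b * b)

    F-≼ : ∀ {v a b} → v ≼ a → v ≼ b → v ℤ.+ v ≼ F a b
    F-≼ {v} h h′ = ≼-- (≼-+ (≼-* h h) (≼-* h h′))
      (≡.subst (_≼ _) (ℤ.+-identityˡ (v ℤ.+ v)) (≼-* δ∈𝒪 (≼-* h′ h′)))

    -- Otherwise Δ = 1 + 4δ differs from (1 + 2x)² by an element of 4𝔭, hence is a square.
    F-residually-anisotropic : ∀ {x} → x ∈ 𝒪 → ¬ (+ 1 ≼ x * x + x - δ)
    F-residually-anisotropic {x} 0≼x h = Δ-nonsquare ((1# + 2# * x) * γ) (begin
      Δ                                               ≈⟨ proj₂ (proj₂ square) ⟩
      (1# + 2# * x) * (1# + 2# * x) * (γ * γ)         ≈⟨ solve 2 (λ u c → u :* u :* (c :* c) := (u :* c) :* (u :* c)) refl (1# + 2# * x) γ ⟩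
      (1# + 2# * x) * γ * ((1# + 2# * x) * γ)         ∎)
      where
      νu² : Val ((1# + 2# * x) * (1# + 2# * x)) (+ 0)
      νu² = val-* (val-1+2y ν2 0≼x) (val-1+2y ν2 0≼x)

      difference : - ((x * x + x - δ) * 4#) ≈ Δ - (1# + 2# * x) * (1# + 2# * x)
      difference = trans
        (solve 2 (λ x δ → :- ((x :* x :+ x :- δ) :* (twoₚ :* twoₚ)) :=
                   (oneₚ :+ twoₚ :* twoₚ :* δ) :- (oneₚ :+ twoₚ :* x) :* (oneₚ :+ twoₚ :* x)) refl x δ)
        (+-congʳ (sym Δ≈1+4δ))

      small : + 1 ℤ.+ (+ 0 ℤ.+ (e ℤ.+ e)) ≼ Δ - (1# + 2# * x) * (1# + 2# * x)
      small = ≡.subst (λ v → + 1 ℤ.+ v ≼ Δ - (1# + 2# * x) * (1# + 2# * x)) (≡.sym (ℤ.+-identityˡ (e ℤ.+ e)))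
        (≼-cong difference (≼-neg (≼-* h (val⇒≼ (val-4 ν2)))))

      square : ∃[ c ] c ≉ 0# × Δ ≈ (1# + 2# * x) * (1# + 2# * x) * (c * c)
      square = local-square-theorem ν2 νu² small

      γ : Carrier
      γ = proj₁ square

    -- Division by b² reduces this to residual anisotropy at the integral element a / b.
    val-F-≥ : ∀ {a b n} → Val b n → n ≼ a → Val (F a b) (n ℤ.+ n)
    val-F-≥ {a} {b} {n} νb n≼a = ≼-sandwich (F-≼ n≼a (val⇒≼ νb))
      λ h → F-residually-anisotropic 0≼x (≼-cancelʳ (val-* νb νb) (≼-cong F≈ h))
      where
      x : Carrier
      x = a * b ⁻¹

      xb≈a : x * b ≈ a
      xb≈a = trans (*-assoc _ _ _) (trans (*-congˡ (inverseˡ (val⇒≉0 νb))) (*-identityʳ a))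

      0≼x : + 0 ≼ x
      0≼x = ≼-cancelʳ νb (≡.subst (_≼ x * b) (≡.sym (ℤ.+-identityˡ n)) (≼-cong (sym xb≈a) n≼a))

      F≈ : F a b ≈ (x * x + x - δ) * (b * b)
      F≈ = trans (+-congʳ (+-cong (*-cong (sym xb≈a) (sym xb≈a)) (*-congʳ (sym xb≈a))))
        (solve 3 (λ x b δ → (x :* b) :* (x :* b) :+ (x :* b) :* b :- δ :* (b :* b) := (x :* x :+ x :- δ) :* (b :* b)) refl x b δ)

    val-F-< : ∀ {a b n} → Val a n → + 1 ℤ.+ n ≼ b → Val (F a b) (n ℤ.+ n)
    val-F-< {a} {b} {n} νa h = val-cong (sym (+-assoc _ _ _)) (val-+ (val-* νa νa)
      (≼-- (≼-weaken bound₁ (≼-* (val⇒≼ νa) h)) (≼-weaken bound₂ (≼-* δ∈𝒪 (≼-* (≼-weaken (ℤ.i≤suc[i] n) h) h)))))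
      where
      bound₁ : + 1 ℤ.+ (n ℤ.+ n) ℤ.≤ n ℤ.+ (+ 1 ℤ.+ n)
      bound₁ = ≤-by-difference {+ 0} {+ 0} ℤ.≤-refl (ℤ-solve (n ∷ []))
      bound₂ : + 1 ℤ.+ (n ℤ.+ n) ℤ.≤ + 0 ℤ.+ (n ℤ.+ (+ 1 ℤ.+ n))
      bound₂ = ≤-by-difference {+ 0} {+ 0} ℤ.≤-refl (ℤ-solve (n ∷ []))

    -- Norms from an unramified quadratic extension have even valuation; in `even`, as produced by
    -- `F-view`, n is the smaller valuation of the two arguments.
    data FView (a b : Carrier) : Set ℓ where
      both-zero : (∀ v → v ≼ a) → (∀ v → v ≼ b) → FView a b
      even      : ∀ n → Val (F a b) (n ℤ.+ n) → n ≼ a → n ≼ b → FView a b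

    F-view : ∀ a b → FView a b
    F-view a b with val? b
    F-view a b | inj₂ (n , νb) with ≼? n a
    ... | inj₁ n≼a            = even n (val-F-≥ νb n≼a) n≼a (val⇒≼ νb)
    ... | inj₂ (m , νa , m<n) = even m (val-F-< νa (≼-weaken m<n (val⇒≼ νb))) (val⇒≼ νa)
                                  (≼-weaken (ℤ.≤-trans (ℤ.i≤suc[i] m) m<n) (val⇒≼ νb))
    F-view a b | inj₁ b≈0 with val? a
    ... | inj₁ a≈0      = both-zero (λ v → ≼-cong (sym a≈0) ≼-0) (λ v → ≼-cong (sym b≈0) ≼-0)
    ... | inj₂ (m , νa) = even m (val-F-< νa (≼-cong (sym b≈0) ≼-0)) (val⇒≼ νa) (≼-cong (sym b≈0) ≼-0)

    module _ {π : Carrier} (νπ : Val π (+ 1)) where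

      val-πF : ∀ {a b} n → Val (F a b) (n ℤ.+ n) → Val (- (π * F a b)) (+ 1 ℤ.+ (n ℤ.+ n))
      val-πF _ νF = val-neg (val-* νπ νF)

      -- The first term has even and the second odd valuation, so they cannot cancel: the smaller
      -- valuation is that of the difference.
      norm-coordinates : ∀ {v} a b c d → v ℤ.+ v ≼ F a b - π * F c d → (v ≼ a × v ≼ b) × (v ≼ c × v ≼ d)
      norm-coordinates {v} a b c d h with F-view a b | F-view c d
      ... | both-zero ha hb | both-zero hc hd = (ha v , hb v) , (hc v , hd v)
      ... | both-zero ha hb | even n νF n≼c n≼d = (ha v , hb v) , (≼-weaken v≤n n≼c , ≼-weaken v≤n n≼d)
        where
        v≤n : v ℤ.≤ n
        v≤n = halve-≤ (val-≤ (val-πF n νF) (≼-cong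
          (solve 2 (λ x y → (x :+ y) :- x := y) refl (F a b) (- (π * F c d))) (≼-- h (F-≼ (ha v) (hb v)))))
      ... | even m νF m≼a m≼b | both-zero hc hd = (≼-weaken v≤m m≼a , ≼-weaken v≤m m≼b) , (hc v , hd v)
        where
        v≤m : v ℤ.≤ m
        v≤m = halve-double-≤ (val-≤ νF (≼-cong
          (solve 2 (λ x y → (x :- y) :+ y := x) refl (F a b) (π * F c d))
          (≼-+ h (≼-weaken (ℤ.i≤j+i (v ℤ.+ v) (+ 1)) (≼-* (val⇒≼ νπ) (F-≼ (hc v) (hd v)))))))
      ... | even m νF m≼a m≼b | even n νF′ n≼c n≼d with m ℤ.≤? n
      ...   | yes m≤n = (≼-weaken v≤m m≼a , ≼-weaken v≤m m≼b) , (≼-weaken v≤n n≼c , ≼-weaken v≤n n≼d)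
        where
        v≤m : v ℤ.≤ m
        v≤m = halve-double-≤ (val-≤ (val-+ νF (≼-weaken (ℤ.+-monoʳ-≤ (+ 1) (ℤ.+-mono-≤ m≤n m≤n)) (val⇒≼ (val-πF n νF′)))) h)
        v≤n : v ℤ.≤ n
        v≤n = ℤ.≤-trans v≤m m≤n
      ...   | no  m≰n = (≼-weaken v≤m m≼a , ≼-weaken v≤m m≼b) , (≼-weaken v≤n n≼c , ≼-weaken v≤n n≼d)
        where
        n<m : + 1 ℤ.+ n ℤ.≤ m
        n<m = ℤ.i<j⇒suc[i]≤j (ℤ.≰⇒> m≰n)
        gap : + 1 ℤ.+ (+ 1 ℤ.+ (n ℤ.+ n)) ℤ.≤ m ℤ.+ m
        gap = ≤-by-difference (ℤ.+-mono-≤ n<m n<m) (ℤ-solve (m ∷ n ∷ []))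
        -- The term with π now dominates, with valuation 2n + 1; `halve-≤` removes the odd unit.
        v≤n : v ℤ.≤ n
        v≤n = halve-≤ (val-≤ (val-cong (+-comm _ _) (val-+ (val-πF n νF′) (≼-weaken gap (val⇒≼ νF)))) h)
        v≤m : v ℤ.≤ m
        v≤m = ℤ.≤-trans v≤n (ℤ.≤-trans (ℤ.i≤suc[i] n) n<m)

  -- Valuation bounds forced by the Hilbert symbol.

  module SymbolBounds {e : ℤ} (ν2 : Val 2# e) where

    -- Z² + A Y² is the norm form of k(a₁), because a₁² = -A.
    norm⇒solvable : ∀ {n A X Y Z} → X ≉ 0# → n * (X * X) ≈ Z * Z + A * (Y * Y) → HilbertSolvable n (- A)
    norm⇒solvable {n} {A} {X} {Y} {Z} X≉0 eq = X , Y , Z , (λ (X≈0 , _) → X≉0 X≈0) ,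
      trans (+-congʳ eq) (solve 3 (λ A Y Z → (Z :* Z :+ A :* (Y :* Y)) :+ (:- A) :* (Y :* Y) := Z :* Z) refl A Y Z)

    -- A = N a₁, n = N (1 - r), N z = w² A, and r₀ + l a₁ is the component of r in k(a₁).
    module _ {A n w r₀ l : Carrier} {f : ℤ}
      (n-not-norm : ¬ HilbertSolvable n (- A))
      (relation : w * w + 4# * (l * l) * A ≈ n * n + 4# * n * r₀)
      (not-square : ∀ x → ¬ ((n - 2# * (1# - r₀)) * (n - 2# * (1# - r₀)) - w * w ≈ x * x))
      (νw : Val w f)
      where

      -- In terms of quaternions, 2s₀ is the trace of 1 - r, M is N r - 1, q is 4Q, and G is four
      -- times the norm of the component of 1 - r in k(a₁).
      s₀ M q G : Carrier
      s₀ = 1# - r₀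
      M  = n - 2# * s₀
      q  = w * w - M * M
      G  = 4# * (s₀ * s₀ + l * l * A)

      -- If ν (M) < f - e, subtracting w² from M² is a change beyond 4 M², so M² - w² would be a
      -- square.
      M-≼ : f ℤ.- e ≼ M
      M-≼ with ≼? (f ℤ.- e) M
      ... | inj₁ h = h
      ... | inj₂ (g , νM , g<f-e) = contradiction
          (trans (proj₂ (proj₂ square)) (solve 2 (λ x y → x :* x :* (y :* y) := (x :* y) :* (x :* y)) refl M (proj₁ square)))
          (not-square (M * proj₁ square))
        where
        bound : + 1 ℤ.+ ((g ℤ.+ g) ℤ.+ (e ℤ.+ e)) ℤ.≤ f ℤ.+ f
        bound = ≤-by-difference (ℤ.+-mono-≤ (ℤ.+-mono-≤ g<f-e g<f-e) 0≤1) (ℤ-solve (e ∷ f ∷ g ∷ []))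
        square : ∃[ x ] x ≉ 0# × M * M - w * w ≈ M * M * (x * x)
        square = local-square-theorem ν2 (val-* νM νM) (≼-cong
          (solve 2 (λ M w → :- (w :* w) := (M :* M :- w :* w) :- M :* M) refl M w)
          (≼-neg (≼-weaken bound (≼-* (val⇒≼ νw) (val⇒≼ νw)))))

      q-≼ : + 2 ℤ.* f ℤ.- + 2 ℤ.* e ≼ q
      q-≼ = ≼-- (≼-weaken bound₁ (≼-* (val⇒≼ νw) (val⇒≼ νw))) (≼-weaken bound₂ (≼-* M-≼ M-≼))
        where
        bound₁ : + 2 ℤ.* f ℤ.- + 2 ℤ.* e ℤ.≤ f ℤ.+ f
        bound₁ = ≤-by-difference (ℤ.+-mono-≤ (ℤ.+-mono-≤ (1≤e ν2) (1≤e ν2)) (ℤ.+-mono-≤ 0≤1 0≤1)) (ℤ-solve (e ∷ f ∷ []))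
        bound₂ : + 2 ℤ.* f ℤ.- + 2 ℤ.* e ℤ.≤ (f ℤ.- e) ℤ.+ (f ℤ.- e)
        bound₂ = ≤-by-difference {+ 0} {+ 0} ℤ.≤-refl (ℤ-solve (e ∷ f ∷ []))

      4n≈G+q : 4# * n ≈ G + q
      4n≈G+q = begin
        4# * n
          ≈⟨ solve 2 (λ n r → fourₚ :* n := n :* n :+ fourₚ :* n :* r :+ fourₚ :* ((oneₚ :- r) :* (oneₚ :- r))
                        :- (n :- twoₚ :* (oneₚ :- r)) :* (n :- twoₚ :* (oneₚ :- r))) refl n r₀ ⟩
        n * n + 4# * n * r₀ + 4# * (s₀ * s₀) - M * M
          ≈⟨ +-congʳ (+-congʳ relation) ⟨
        w * w + 4# * (l * l) * A + 4# * (s₀ * s₀) - M * M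
          ≈⟨ solve 5 (λ A w s l M → w :* w :+ fourₚ :* (l :* l) :* A :+ fourₚ :* (s :* s) :- M :* M :=
                fourₚ :* (s :* s :+ l :* l :* A) :+ (w :* w :- M :* M)) refl A w s₀ l M ⟩
        G + q ∎

      -- If G had smaller valuation, q would be negligible, and 4n = G + q would be a square times
      -- the norm G. Then n itself would be a norm from k(a₁).
      G-≼ : + 2 ℤ.* f ℤ.- + 4 ℤ.* e ≼ G
      G-≼ with ≼? (+ 2 ℤ.* f ℤ.- + 4 ℤ.* e) G
      ... | inj₁ h = h
      ... | inj₂ (g , νG , g<) = ⊥-elim (n-not-norm (norm⇒solvable {X = 2#} {Y = 2# * x * l} {Z = 2# * x * s₀} (val⇒≉0 ν2) (begin
          n * (2# * 2#)                                ≈⟨ *-comm n 4# ⟩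
          4# * n                                       ≈⟨ 4n≈G+q ⟩
          G + q                                        ≈⟨ proj₂ (proj₂ square) ⟩
          G * (x * x)                                  ≈⟨ solve 4 (λ A x s l → fourₚ :* (s :* s :+ l :* l :* A) :* (x :* x) :=
                                                            twoₚ :* x :* s :* (twoₚ :* x :* s) :+ A :* (twoₚ :* x :* l :* (twoₚ :* x :* l))) refl A x s₀ l ⟩
          2# * x * s₀ * (2# * x * s₀) + A * (2# * x * l * (2# * x * l)) ∎)))
        where
        bound : + 1 ℤ.+ (g ℤ.+ (e ℤ.+ e)) ℤ.≤ + 2 ℤ.* f ℤ.- + 2 ℤ.* e
        bound = ≤-by-difference {+ 1 ℤ.+ g} {+ 2 ℤ.* f ℤ.- + 4 ℤ.* e} g< (ℤ-solve (e ∷ f ∷ g ∷ []))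
        square : ∃[ x ] x ≉ 0# × G + q ≈ G * (x * x)
        square = local-square-theorem ν2 νG (≼-cong (solve 2 (λ x y → y := (x :+ y) :- x) refl G q) (≼-weaken bound q-≼))
        x : Carrier
        x = proj₁ square

      n-≼ : + 2 ℤ.* f ℤ.- + 6 ℤ.* e ≼ n
      n-≼ = ≼-cancelʳ (val-4 ν2) (≼-cong (trans (sym 4n≈G+q) (*-comm 4# n))
        (≼-weaken bound₁ (≼-+ G-≼ (≼-weaken bound₂ q-≼))))
        where
        bound₁ : + 2 ℤ.* f ℤ.- + 6 ℤ.* e ℤ.+ (e ℤ.+ e) ℤ.≤ + 2 ℤ.* f ℤ.- + 4 ℤ.* e
        bound₁ = ≤-by-difference {+ 0} {+ 0} ℤ.≤-refl (ℤ-solve (e ∷ f ∷ []))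
        bound₂ : + 2 ℤ.* f ℤ.- + 4 ℤ.* e ℤ.≤ + 2 ℤ.* f ℤ.- + 2 ℤ.* e
        bound₂ = ≤-by-difference (ℤ.+-mono-≤ (ℤ.+-mono-≤ (1≤e ν2) (1≤e ν2)) (ℤ.+-mono-≤ 0≤1 0≤1)) (ℤ-solve (e ∷ f ∷ []))

      -- Otherwise n + 4 r₀ = N (1 + r) would be a square, making n a norm.
      not-both-small : + 1 ℤ.+ + 4 ℤ.* e ≼ n → ¬ (+ 1 ℤ.+ + 2 ℤ.* e ≼ s₀)
      not-both-small hn hs = n-not-norm (norm⇒solvable {X = 2# * x} {Y = 2# * l} {Z = w} (≉0-* (val⇒≉0 ν2) x≉0) (begin
          n * (2# * x * (2# * x))                      ≈⟨ solve 2 (λ n x → n :* (twoₚ :* x :* (twoₚ :* x)) := n :* (fourₚ :* (x :* x))) refl n x ⟩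
          n * (4# * (x * x))                           ≈⟨ *-congˡ (proj₂ (proj₂ square)) ⟨
          n * (n + 4# * r₀)                            ≈⟨ solve 2 (λ n r → n :* (n :+ fourₚ :* r) := n :* n :+ fourₚ :* n :* r) refl n r₀ ⟩
          n * n + 4# * n * r₀                          ≈⟨ relation ⟨
          w * w + 4# * (l * l) * A                     ≈⟨ solve 3 (λ A w l → w :* w :+ fourₚ :* (l :* l) :* A := w :* w :+ A :* (twoₚ :* l :* (twoₚ :* l))) refl A w l ⟩
          w * w + A * (2# * l * (2# * l))              ∎))
        where
        bound₁ : + 1 ℤ.+ ((e ℤ.+ e) ℤ.+ (e ℤ.+ e)) ℤ.≤ + 1 ℤ.+ + 4 ℤ.* e
        bound₁ = ≤-by-difference {+ 0} {+ 0} ℤ.≤-refl (ℤ-solve (e ∷ []))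
        bound₂ : + 1 ℤ.+ ((e ℤ.+ e) ℤ.+ (e ℤ.+ e)) ℤ.≤ (e ℤ.+ e) ℤ.+ (+ 1 ℤ.+ + 2 ℤ.* e)
        bound₂ = ≤-by-difference {+ 0} {+ 0} ℤ.≤-refl (ℤ-solve (e ∷ []))
        square : ∃[ x ] x ≉ 0# × n + 4# * r₀ ≈ 4# * (x * x)
        square = local-square-theorem ν2 (val-4 ν2) (≼-cong
          (solve 2 (λ n r → n :- fourₚ :* (oneₚ :- r) := (n :+ fourₚ :* r) :- fourₚ) refl n r₀)
          (≼-- (≼-weaken bound₁ hn) (≼-weaken bound₂ (≼-* (val⇒≼ (val-4 ν2)) hs))))
        x : Carrier
        x = proj₁ square
        x≉0 : x ≉ 0#
        x≉0 = proj₁ (proj₂ square)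

      -- Assuming f ≥ 6e gives ν (n) ≥ 6e and ν (M) ≥ 5e. Then 2s₀ = n - M yields ν (s₀) ≥ 4e, and
      -- as e ≥ 1 both thresholds of `not-both-small` are met.
      val-w-< : + 1 ℤ.+ f ℤ.≤ + 6 ℤ.* e
      val-w-< with + 6 ℤ.* e ℤ.≤? f
      ... | no  6e≰f = ℤ.i<j⇒suc[i]≤j (ℤ.≰⇒> 6e≰f)
      ... | yes f≥6e = ⊥-elim (not-both-small (≼-weaken bound₁ n-≼) (≼-weaken bound₂ 4e≼s₀))
        where
        6e≤f : + 6 ℤ.* e ℤ.≤ f
        6e≤f = f≥6e
        bound₁ : + 1 ℤ.+ + 4 ℤ.* e ℤ.≤ + 2 ℤ.* f ℤ.- + 6 ℤ.* e
        bound₁ = ≤-by-difference (ℤ.+-mono-≤ (ℤ.+-mono-≤ 6e≤f 6e≤f) (ℤ.+-mono-≤ (1≤e ν2) (ℤ.+-mono-≤ (1≤e ν2) 0≤1))) (ℤ-solve (e ∷ f ∷ []))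
        bound₂ : + 1 ℤ.+ + 2 ℤ.* e ℤ.≤ + 4 ℤ.* e
        bound₂ = ≤-by-difference (ℤ.+-mono-≤ (1≤e ν2) (ℤ.+-mono-≤ (1≤e ν2) 0≤1)) (ℤ-solve (e ∷ []))
        bound₃ : + 4 ℤ.* e ℤ.+ e ℤ.≤ + 2 ℤ.* f ℤ.- + 6 ℤ.* e
        bound₃ = ≤-by-difference (ℤ.+-mono-≤ (ℤ.+-mono-≤ 6e≤f 6e≤f) (ℤ.+-mono-≤ (1≤e ν2) 0≤1)) (ℤ-solve (e ∷ f ∷ []))
        bound₄ : + 4 ℤ.* e ℤ.+ e ℤ.≤ f ℤ.- e
        bound₄ = ≤-by-difference 6e≤f (ℤ-solve (e ∷ f ∷ []))
        4e≼s₀ : + 4 ℤ.* e ≼ s₀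
        4e≼s₀ = ≼-cancelʳ ν2 (≼-cong
          (solve 2 (λ n s → n :- (n :- twoₚ :* s) := s :* twoₚ) refl n s₀)
          (≼-- (≼-weaken bound₃ n-≼) (≼-weaken bound₄ M-≼)))

      -- The trace estimate of D enters as a hypothesis, because only elements of k occur here.
      -- Applied at 2 + 6e = 2(1 + 3e), it forces ν (s₀) ≥ 1 + 2e.
      n-⋠ : (∀ v → v ℤ.+ v ≼ n → v ≼ 2# * s₀) → ¬ (+ 2 ℤ.+ + 6 ℤ.* e ≼ n)
      n-⋠ trace-bound h = not-both-small (≼-weaken bound₁ h) (≼-cancelʳ ν2 (≼-cong (*-comm 2# s₀)
        (≼-weaken bound₂ (trace-bound (+ 1 ℤ.+ + 3 ℤ.* e) (≼-weaken bound₃ h)))))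
        where
        bound₁ : + 1 ℤ.+ + 4 ℤ.* e ℤ.≤ + 2 ℤ.+ + 6 ℤ.* e
        bound₁ = ≤-by-difference (ℤ.+-mono-≤ (ℤ.+-mono-≤ (1≤e ν2) (1≤e ν2)) (ℤ.+-mono-≤ 0≤1 (ℤ.+-mono-≤ 0≤1 0≤1))) (ℤ-solve (e ∷ []))
        bound₂ : + 1 ℤ.+ + 2 ℤ.* e ℤ.+ e ℤ.≤ + 1 ℤ.+ + 3 ℤ.* e
        bound₂ = ≤-by-difference {+ 0} {+ 0} ℤ.≤-refl (ℤ-solve (e ∷ []))
        bound₃ : (+ 1 ℤ.+ + 3 ℤ.* e) ℤ.+ (+ 1 ℤ.+ + 3 ℤ.* e) ℤ.≤ + 2 ℤ.+ + 6 ℤ.* e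
        bound₃ = ≤-by-difference {+ 0} {+ 0} ℤ.≤-refl (ℤ-solve (e ∷ []))

  -- Norm, trace and coordinates in the division algebra.

  module DivisionAlgebra
    {e : ℤ} (ν2 : Val 2# e) (π : Carrier) (νπ : Val π (+ 1))
    (Δ δ : Carrier) (Δ-nonsquare : ∀ x → ¬ (Δ ≈ x * x)) (δ∈𝒪 : δ ∈ 𝒪) (Δ≈1+4δ : Δ ≈ 1# + 4# * δ)
    where

    open QuaternionAlgebra k π Δ
    open UnramifiedForm ν2 Δ δ Δ-nonsquare δ∈𝒪 Δ≈1+4δ
    open SymbolBounds ν2
    open QuaternionIdentities k π Δ

    0≤e : + 0 ℤ.≤ e
    0≤e = ℤ.≤-trans 0≤1 (1≤e ν2)

    x²-Δy²≈F : ∀ x y → x * x - Δ * (y * y) ≈ F (x - y) (2# * y)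
    x²-Δy²≈F x y = trans (+-congˡ (-‿cong (*-congʳ Δ≈1+4δ)))
      (solve 3 (λ δ x y → x :* x :- (oneₚ :+ fourₚ :* δ) :* (y :* y) :=
        (x :- y) :* (x :- y) :+ (x :- y) :* (twoₚ :* y) :- δ :* (twoₚ :* y :* (twoₚ :* y))) refl δ x y)

    -- D is the orthogonal sum of k(ω) and i k(ω), and N i = -π.
    N≈F-πF : ∀ q → N q ≈ F (x₀ q - x₂ q) (2# * x₂ q) - π * F (x₁ q - x₃ q) (2# * x₃ q)
    N≈F-πF (quat a₀ a₁ a₂ a₃) = trans
      (solve 6 (λ π Δ a₀ a₁ a₂ a₃ → normₚ π Δ (quatₚ a₀ a₁ a₂ a₃) :=
        (a₀ :* a₀ :- Δ :* (a₂ :* a₂)) :- π :* (a₁ :* a₁ :- Δ :* (a₃ :* a₃))) refl π Δ a₀ a₁ a₂ a₃)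
      (+-cong (x²-Δy²≈F a₀ a₂) (-‿cong (*-congˡ (x²-Δy²≈F a₁ a₃))))

    -- The four elements are the coordinates of q in the basis 1, ω, i, iω.
    Coordinates≼ : ℤ → D → Set
    Coordinates≼ v q = (v ≼ x₀ q - x₂ q × v ≼ 2# * x₂ q) × (v ≼ x₁ q - x₃ q × v ≼ 2# * x₃ q)

    N≼⇒coordinates≼ : ∀ {v} q → v ℤ.+ v ≼ N q → Coordinates≼ v q
    N≼⇒coordinates≼ q h = norm-coordinates νπ _ _ _ _ (≼-cong (N≈F-πF q) h)

    coordinates≼⇒N≼ : ∀ {v} q → Coordinates≼ v q → v ℤ.+ v ≼ N q
    coordinates≼⇒N≼ {v} q ((h₀ , h₂) , (h₁ , h₃)) = ≼-cong (sym (N≈F-πF q))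
      (≼-- (F-≼ h₀ h₂) (≼-weaken (ℤ.i≤j+i (v ℤ.+ v) (+ 1)) (≼-* (val⇒≼ νπ) (F-≼ h₁ h₃))))

    trace-≼ : ∀ {v} q → v ℤ.+ v ≼ N q → v ≼ 2# * x₀ q
    trace-≼ {v} q h = let (h₀ , h₂) , _ = N≼⇒coordinates≼ q h in ≼-cong
      (solve 2 (λ x y → twoₚ :* (x :- y) :+ twoₚ :* y := twoₚ :* x) refl (x₀ q) (x₂ q))
      (≼-+ (≼-weaken v≤e+v (≼-* (val⇒≼ ν2) h₀)) h₂)
      where
      v≤e+v : v ℤ.≤ e ℤ.+ v
      v≤e+v = ≤-by-difference 0≤e (ℤ-solve (e ∷ v ∷ []))

    -- A non-archimedean Cauchy-Schwarz inequality: T p q is the trace of p q̄, which has norm N p ·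
    -- N q.
    T-≼ : ∀ {v} p q → v ℤ.+ v ≼ N p * N q → v ≼ T p q
    T-≼ p q h = trace-≼ (p *ᴰ conj q) (≼-cong (sym (trans (N-* p (conj q)) (*-congˡ (N-conj q)))) h)

    N‿+ᴰ-≼ : ∀ {v} p q → v ≼ N p → v ≼ N q → v ≼ N (p +ᴰ q)
    N‿+ᴰ-≼ p q hp hq = ≼-cong (sym (N-+ p q)) (≼-+ (≼-+ hp (T-≼ p q (≼-* hp hq))) hq)

    N‿-ᴰ-≼ : ∀ {v} p q → v ≼ N p → v ≼ N q → v ≼ N (p -ᴰ q)
    N‿-ᴰ-≼ p q hp hq = ≼-cong (sym (N-- p q)) (≼-+ (≼-- hp (T-≼ p q (≼-* hp hq))) hq)

    2x≈0⇒x≈0 : ∀ {x} → 2# * x ≈ 0# → x ≈ 0#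
    2x≈0⇒x≈0 {x} eq = *-cancelʳ-≉0 (val⇒≉0 ν2) (trans (*-comm x 2#) (trans eq (sym (zeroˡ 2#))))

    N≈0⇒x₀≈0 : ∀ q → N q ≈ 0# → x₀ q ≈ 0#
    N≈0⇒x₀≈0 q N≈0 = 2x≈0⇒x≈0 (∀≼⇒≈0 λ v → trace-≼ q (≼-cong (sym N≈0) ≼-0))

    -- Perturbing a solution of the star conditions.

    module Perturbation (b₁ b₂ b₃ : Carrier) (t : ℤ) (r : D) (0≼Nr : + 0 ≼ N r) (star : KStar (imag b₁ b₂ b₃) t r) where

      open KStar star

      a : D
      a = imag b₁ b₂ b₃

      A m n r₀ b : Carrier
      A  = N a
      m  = N r
      n  = N (1ᴰ -ᴰ r)
      r₀ = x₀ r
      b  = x₀ (r *ᴰ conj a)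

      n≉0 : n ≉ 0#
      n≉0 = proj₁ symbol

      n-not-norm : ¬ HilbertSolvable n (- A)
      n-not-norm = proj₂ (proj₂ symbol)

      -A≉0 : - A ≉ 0#
      -A≉0 = proj₁ (proj₂ symbol)

      A≉0 : A ≉ 0#
      A≉0 A≈0 = -A≉0 (trans (-‿cong A≈0) (solve 0 (:- zeroₚ := zeroₚ) refl))

      -- From N z · A = y² follows N z = (y / A)² A. The multiple l a is the projection of r to the
      -- line of a.
      y w l : Carrier
      y = proj₁ square
      w = y * A ⁻¹
      l = b * A ⁻¹

      lA≈b : l * A ≈ b
      lA≈b = trans (*-assoc b (A ⁻¹) A) (trans (*-congˡ (inverseˡ A≉0)) (*-identityʳ b))

      wA≈y : w * A ≈ y
      wA≈y = trans (*-assoc y (A ⁻¹) A) (trans (*-congˡ (inverseˡ A≉0)) (*-identityʳ y))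

      w≉0 : w ≉ 0#
      w≉0 w≈0 = proj₁ (proj₂ square) (trans (sym wA≈y) (trans (*-congʳ w≈0) (zeroˡ A)))

      Nz≈w²A : N z ≈ w * w * A
      Nz≈w²A = *-cancelʳ-≉0 A≉0 (begin
        N z * A            ≈⟨ proj₂ (proj₂ square) ⟩
        y * y              ≈⟨ *-cong wA≈y wA≈y ⟨
        w * A * (w * A)    ≈⟨ solve 2 (λ w A → w :* A :* (w :* A) := w :* w :* A :* A) refl w A ⟩
        w * w * A * A      ∎)

      -- The norm of the component of r orthogonal to k(a).
      Q : Carrier
      Q = (m - r₀ * r₀) - l * l * A

      w²≈ : w * w ≈ (m - 1#) * (m - 1#) + 4# * Q
      w²≈ = *-cancelʳ-≉0 A≉0 (begin
        w * w * A
          ≈⟨ Nz≈w²A ⟨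
        N z
          ≈⟨ N-a-rar̄ r b₁ b₂ b₃ ⟩
        A * ((m - 1#) * (m - 1#)) + 4# * ((m - r₀ * r₀) * A - b * b)
          ≈⟨ +-congˡ (*-congˡ (+-congˡ (-‿cong (*-cong lA≈b lA≈b)))) ⟨
        A * ((m - 1#) * (m - 1#)) + 4# * ((m - r₀ * r₀) * A - l * A * (l * A))
          ≈⟨ solve 4 (λ A m r l → A :* ((m :- oneₚ) :* (m :- oneₚ)) :+ fourₚ :* ((m :- r :* r) :* A :- l :* A :* (l :* A)) :=
                ((m :- oneₚ) :* (m :- oneₚ) :+ fourₚ :* ((m :- r :* r) :- l :* l :* A)) :* A) refl A m r₀ l ⟩
        ((m - 1#) * (m - 1#) + 4# * Q) * A ∎)

      n≈ : n ≈ m + 1# - 2# * r₀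
      n≈ = N-1- r

      -- Both sides are n · N (1 + r), since N (1 + r) = n + 4r₀; the left one displays it as the
      -- norm of w + 2l a.
      relation : w * w + 4# * (l * l) * A ≈ n * n + 4# * n * r₀
      relation = begin
        w * w + 4# * (l * l) * A
          ≈⟨ +-congʳ w²≈ ⟩
        (m - 1#) * (m - 1#) + 4# * Q + 4# * (l * l) * A
          ≈⟨ solve 4 (λ A m r l → (m :- oneₚ) :* (m :- oneₚ) :+ fourₚ :* ((m :- r :* r) :- l :* l :* A) :+ fourₚ :* (l :* l) :* A :=
                (m :+ oneₚ :- twoₚ :* r) :* (m :+ oneₚ :- twoₚ :* r) :+ fourₚ :* (m :+ oneₚ :- twoₚ :* r) :* r) refl A m r₀ l ⟩
        (m + 1# - 2# * r₀) * (m + 1# - 2# * r₀) + 4# * (m + 1# - 2# * r₀) * r₀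
          ≈⟨ +-cong (*-cong n≈ n≈) (*-congʳ (*-congˡ n≈)) ⟨
        n * n + 4# * n * r₀ ∎

      -- Otherwise n would be the norm of (1 - r₀) - l a, an element of k(a).
      Q≉0 : Q ≉ 0#
      Q≉0 Q≈0 = n-not-norm (norm⇒solvable {X = 1#} {Y = l} {Z = 1# - r₀} 1≉0 (begin
        n * (1# * 1#)
          ≈⟨ *-congʳ n≈ ⟩
        (m + 1# - 2# * r₀) * (1# * 1#)
          ≈⟨ solve 4 (λ A m r l → (m :+ oneₚ :- twoₚ :* r) :* (oneₚ :* oneₚ) :=
                (oneₚ :- r) :* (oneₚ :- r) :+ A :* (l :* l) :+ ((m :- r :* r) :- l :* l :* A)) refl A m r₀ l ⟩
        (1# - r₀) * (1# - r₀) + A * (l * l) + Q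
          ≈⟨ +-congˡ Q≈0 ⟩
        (1# - r₀) * (1# - r₀) + A * (l * l) + 0#
          ≈⟨ +-identityʳ _ ⟩
        (1# - r₀) * (1# - r₀) + A * (l * l) ∎))

      -- If M² - w² = x², the quaternion 2r″ + x, where r″ is the component of r orthogonal to k(a), has norm 0.
      not-square : ∀ x → ¬ ((n - 2# * (1# - r₀)) * (n - 2# * (1# - r₀)) - w * w ≈ x * x)
      not-square x eq = Q≉0 (2x≈0⇒x≈0 (2x≈0⇒x≈0 (trans (sym (*-assoc 2# 2# Q)) 4Q≈0)))
        where
        M≈ : n - 2# * (1# - r₀) ≈ m - 1#
        M≈ = trans (+-congʳ n≈) (solve 2 (λ m r → (m :+ oneₚ :- twoₚ :* r) :- twoₚ :* (oneₚ :- r) := m :- oneₚ) refl m r₀)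

        x²≈-4Q : x * x ≈ - (4# * Q)
        x²≈-4Q = begin
          x * x ≈⟨ eq ⟨
          (n - 2# * (1# - r₀)) * (n - 2# * (1# - r₀)) - w * w ≈⟨ +-cong (*-cong M≈ M≈) (-‿cong w²≈) ⟩
          (m - 1#) * (m - 1#) - ((m - 1#) * (m - 1#) + 4# * Q)
            ≈⟨ solve 2 (λ M q → M :- (M :+ q) := :- q) refl ((m - 1#) * (m - 1#)) (4# * Q) ⟩
          - (4# * Q) ∎

        p : D
        p = quat x (2# * (x₁ r - l * b₁)) (2# * (x₂ r - l * b₂)) (2# * (x₃ r - l * b₃))

        Np≈0 : N p ≈ 0#
        Np≈0 = begin
          N p
            ≈⟨ N-shifted-imag r b₁ b₂ b₃ x l ⟩
          x * x + 4# * ((m - r₀ * r₀) - 2# * l * b + l * l * A)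
            ≈⟨ +-cong x²≈-4Q (*-congˡ (+-congʳ (+-congˡ (-‿cong (*-congˡ (sym lA≈b)))))) ⟩
          - (4# * Q) + 4# * ((m - r₀ * r₀) - 2# * l * (l * A) + l * l * A)
            ≈⟨ solve 3 (λ A μ l → :- (fourₚ :* (μ :- l :* l :* A)) :+ fourₚ :* (μ :- twoₚ :* l :* (l :* A) :+ l :* l :* A) := zeroₚ)
                 refl A (m - r₀ * r₀) l ⟩
          0# ∎

        4Q≈0 : 4# * Q ≈ 0#
        4Q≈0 = begin
          4# * Q              ≈⟨ solve 1 (λ q → q := :- (:- q)) refl (4# * Q) ⟩
          - (- (4# * Q))      ≈⟨ -‿cong x²≈-4Q ⟨
          - (x * x)           ≈⟨ -‿cong (*-congʳ (N≈0⇒x₀≈0 p Np≈0)) ⟩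
          - (0# * x)          ≈⟨ solve 1 (λ x → :- (zeroₚ :* x) := zeroₚ) refl x ⟩
          0#                  ∎

      module _ {α f η : ℤ} (νA : Val A α) (νw : Val w f) (νn : Val n η) where

        f<6e : + 1 ℤ.+ f ℤ.≤ + 6 ℤ.* e
        f<6e = val-w-< n-not-norm relation not-square νw

        -- The form 1 + (3e + 3e) is what `halve-≤` needs to conclude v ≤ 3e.
        η≤1+6e : η ℤ.≤ + 1 ℤ.+ (+ 3 ℤ.* e ℤ.+ + 3 ℤ.* e)
        η≤1+6e with η ℤ.≤? + 1 ℤ.+ (+ 3 ℤ.* e ℤ.+ + 3 ℤ.* e)
        ... | yes h = h
        ... | no ¬h = ⊥-elim (n-⋠ n-not-norm relation not-square νw (λ v → trace-≼ (1ᴰ -ᴰ r))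
                        (≼-weaken bound₀ (val⇒≼ νn)))
          where
          η> : + 1 ℤ.+ (+ 1 ℤ.+ (+ 3 ℤ.* e ℤ.+ + 3 ℤ.* e)) ℤ.≤ η
          η> = ℤ.i<j⇒suc[i]≤j (ℤ.≰⇒> ¬h)
          bound₀ : + 2 ℤ.+ + 6 ℤ.* e ℤ.≤ η
          bound₀ = ≤-by-difference η> (ℤ-solve (e ∷ η ∷ []))

        νNz : Val (N z) (f ℤ.+ f ℤ.+ α)
        νNz = val-cong (sym Nz≈w²A) (val-* (val-* νw νw) νA)

        z-pure : IsPure z
        z-pure = trans (+-congˡ (-‿cong (x₀-sandwich-imag r b₁ b₂ b₃))) (solve 0 (zeroₚ :- zeroₚ := zeroₚ) refl)

        module _ {u v : ℤ} (7e≤u : + 7 ℤ.* e ℤ.≤ u) (v+v≤η : v ℤ.+ v ℤ.≤ η) (η≤1+v+v : η ℤ.≤ + 1 ℤ.+ (v ℤ.+ v))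
          (s : D) (Nh-≼ : u ℤ.+ u ≼ N (s -ᴰ r)) where

          h x x′ d z′ : D
          h  = s -ᴰ r
          x  = h *ᴰ a *ᴰ conj r
          x′ = h *ᴰ a *ᴰ conj h
          d  = (x -ᴰ conj x) +ᴰ x′
          z′ = a -ᴰ s *ᴰ a *ᴰ conj s

          v≤3e : v ℤ.≤ + 3 ℤ.* e
          v≤3e = halve-≤ (ℤ.≤-trans v+v≤η η≤1+6e)

          0≤2e : + 0 ℤ.+ + 0 ℤ.≤ e ℤ.+ e
          0≤2e = ℤ.+-mono-≤ 0≤e 0≤e

          N[1-s]-n≈ : N h - T (1ᴰ -ᴰ r) h ≈ N (1ᴰ -ᴰ s) - n
          N[1-s]-n≈ = begin
            N h - T (1ᴰ -ᴰ r) h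
              ≈⟨ solve 3 (λ n t h → h :- t := (n :- t :+ h) :- n) refl n (T (1ᴰ -ᴰ r) h) (N h) ⟩
            (n - T (1ᴰ -ᴰ r) h + N h) - n
              ≈⟨ +-congʳ (N-- (1ᴰ -ᴰ r) h) ⟨
            N ((1ᴰ -ᴰ r) -ᴰ h) - n
              ≈⟨ +-congʳ (N-cong (same , same , same , same)) ⟩
            N (1ᴰ -ᴰ s) - n ∎
            where
            same : ∀ {o r s} → (o - r) - (s - r) ≈ o - s
            same {o} {r} {s} = solve 3 (λ o r s → (o :- r) :- (s :- r) := o :- s) refl o r s

          -- The weaker bound is v + u, from the trace term. By η ≤ 1 + 2v and v ≤ 3e, the required
          -- 1 + η + 2e is at most v + 5e + 2, and 2 ≤ 2e brings this below v + u.
          N[1-s]-n-≼ : + 1 ℤ.+ (η ℤ.+ (e ℤ.+ e)) ≼ N (1ᴰ -ᴰ s) - n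
          N[1-s]-n-≼ = ≼-cong N[1-s]-n≈ (≼-weaken bound₁ (≼-- (≼-weaken bound₂ Nh-≼)
            (T-≼ (1ᴰ -ᴰ r) h (≼-weaken bound₃ (≼-* (val⇒≼ νn) Nh-≼)))))
            where
            bound₁ : + 1 ℤ.+ (η ℤ.+ (e ℤ.+ e)) ℤ.≤ v ℤ.+ u
            bound₁ = ≤-by-difference (ℤ.+-mono-≤ (ℤ.+-mono-≤ η≤1+v+v v≤3e) (ℤ.+-mono-≤ 7e≤u (ℤ.+-mono-≤ (1≤e ν2) (1≤e ν2))))
              (ℤ-solve (e ∷ u ∷ v ∷ η ∷ []))
            bound₂ : v ℤ.+ u ℤ.≤ u ℤ.+ u
            bound₂ = ≤-by-difference (ℤ.+-mono-≤ (ℤ.+-mono-≤ v≤3e 7e≤u) (ℤ.+-mono-≤ 0≤2e 0≤2e)) (ℤ-solve (e ∷ u ∷ v ∷ []))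
            bound₃ : (v ℤ.+ u) ℤ.+ (v ℤ.+ u) ℤ.≤ η ℤ.+ (u ℤ.+ u)
            bound₃ = ≤-by-difference v+v≤η (ℤ-solve (u ∷ v ∷ η ∷ []))

          1+f+e≤u : + 1 ℤ.+ f ℤ.+ e ℤ.≤ u
          1+f+e≤u = ≤-by-difference (ℤ.+-mono-≤ 7e≤u f<6e) (ℤ-solve (e ∷ f ∷ u ∷ []))

          e≤u : e ℤ.≤ u
          e≤u = ≤-by-difference (ℤ.+-mono-≤ 7e≤u (ℤ.+-mono-≤ 0≤2e (ℤ.+-mono-≤ 0≤2e 0≤2e))) (ℤ-solve (e ∷ u ∷ []))

          0≤u : + 0 ℤ.≤ u
          0≤u = ℤ.≤-trans 0≤e e≤u

          Nx-≼ : u ℤ.+ u ℤ.+ α ≼ N x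
          Nx-≼ = ≼-cong (sym (N-sandwich h a r)) (≡.subst (_≼ N h * A * N r) (ℤ.+-identityʳ (u ℤ.+ u ℤ.+ α)) (≼-* (≼-* Nh-≼ (val⇒≼ νA)) 0≼Nr))

          Nx′-≼ : u ℤ.+ u ℤ.+ α ℤ.+ (u ℤ.+ u) ≼ N x′
          Nx′-≼ = ≼-cong (sym (N-sandwich h a h)) (≼-* (≼-* Nh-≼ (val⇒≼ νA)) Nh-≼)

          Nd-≼ : u ℤ.+ u ℤ.+ α ≼ N d
          Nd-≼ = N‿+ᴰ-≼ (x -ᴰ conj x) x′ (N‿-ᴰ-≼ x (conj x) Nx-≼ (≼-cong (sym (N-conj x)) Nx-≼)) (≼-weaken bound₀ Nx′-≼)
            where
            bound₀ : u ℤ.+ u ℤ.+ α ℤ.≤ u ℤ.+ u ℤ.+ α ℤ.+ (u ℤ.+ u)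
            bound₀ = ≤-by-difference (ℤ.+-mono-≤ 0≤u 0≤u) (ℤ-solve (u ∷ α ∷ []))

          Nz′-Nz≈ : N d - (2# * T z x + T z x′) ≈ N z′ - N z
          Nz′-Nz≈ = begin
            N d - (2# * T z x + T z x′)
              ≈⟨ +-congˡ (-‿cong (trans (T-+ z (x -ᴰ conj x) x′) (+-congʳ (T-imag-x-x̄ {z} z-pure x)))) ⟨
            N d - T z d
              ≈⟨ solve 3 (λ n t h → h :- t := (n :- t :+ h) :- n) refl (N z) (T z d) (N d) ⟩
            (N z - T z d + N d) - N z
              ≈⟨ +-congʳ (N-- z d) ⟨
            N (z -ᴰ d) - N z
              ≈⟨ +-congʳ (N-cong (sandwich-perturb r s b₁ b₂ b₃)) ⟨
            N z′ - N z ∎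

          -- The critical term is 2 T(z, x). Its factor 2 supplies e, so u ≥ 1 + f + e suffices;
          -- T(z, x) alone would require u ≥ 1 + f + 2e, which f ≤ 6e - 1 and u ≥ 7e do not give.
          Nz′-Nz-≼ : + 1 ℤ.+ (f ℤ.+ f ℤ.+ α ℤ.+ (e ℤ.+ e)) ≼ N z′ - N z
          Nz′-Nz-≼ = ≼-cong Nz′-Nz≈ (≼-- (≼-weaken bound₁ Nd-≼) (≼-+
            (≼-weaken bound₂ (≼-* (val⇒≼ ν2) (T-≼ z x (≼-weaken bound₃ (≼-* (val⇒≼ νNz) Nx-≼)))))
            (≼-weaken bound₄ (T-≼ z x′ (≼-weaken bound₅ (≼-* (val⇒≼ νNz) Nx′-≼))))))
            where
            bound₁ : + 1 ℤ.+ (f ℤ.+ f ℤ.+ α ℤ.+ (e ℤ.+ e)) ℤ.≤ u ℤ.+ u ℤ.+ α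
            bound₁ = ≤-by-difference (ℤ.+-mono-≤ (ℤ.+-mono-≤ 1+f+e≤u 1+f+e≤u) 0≤1) (ℤ-solve (e ∷ f ∷ u ∷ α ∷ []))
            bound₂ : + 1 ℤ.+ (f ℤ.+ f ℤ.+ α ℤ.+ (e ℤ.+ e)) ℤ.≤ e ℤ.+ (f ℤ.+ u ℤ.+ α)
            bound₂ = ≤-by-difference 1+f+e≤u (ℤ-solve (e ∷ f ∷ u ∷ α ∷ []))
            bound₃ : (f ℤ.+ u ℤ.+ α) ℤ.+ (f ℤ.+ u ℤ.+ α) ℤ.≤ f ℤ.+ f ℤ.+ α ℤ.+ (u ℤ.+ u ℤ.+ α)
            bound₃ = ≤-by-difference {+ 0} {+ 0} ℤ.≤-refl (ℤ-solve (f ∷ u ∷ α ∷ []))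
            bound₄ : + 1 ℤ.+ (f ℤ.+ f ℤ.+ α ℤ.+ (e ℤ.+ e)) ℤ.≤ f ℤ.+ α ℤ.+ (u ℤ.+ u)
            bound₄ = ≤-by-difference (ℤ.+-mono-≤ 1+f+e≤u e≤u) (ℤ-solve (e ∷ f ∷ u ∷ α ∷ []))
            bound₅ : (f ℤ.+ α ℤ.+ (u ℤ.+ u)) ℤ.+ (f ℤ.+ α ℤ.+ (u ℤ.+ u)) ℤ.≤ f ℤ.+ f ℤ.+ α ℤ.+ (u ℤ.+ u ℤ.+ α ℤ.+ (u ℤ.+ u))
            bound₅ = ≤-by-difference {+ 0} {+ 0} ℤ.≤-refl (ℤ-solve (f ∷ u ∷ α ∷ []))

          νNz′ : Val (N z′) (f ℤ.+ f ℤ.+ α)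
          νNz′ = val-cong (solve 2 (λ x y → x :+ (y :- x) := y) refl (N z) (N z′)) (val-+ νNz (≼-weaken bound₀ Nz′-Nz-≼))
            where
            bound₀ : + 1 ℤ.+ (f ℤ.+ f ℤ.+ α) ℤ.≤ + 1 ℤ.+ (f ℤ.+ f ℤ.+ α ℤ.+ (e ℤ.+ e))
            bound₀ = ≤-by-difference 0≤2e (ℤ-solve (e ∷ f ∷ α ∷ []))

          perturbed-bounded : KStar a t s
          perturbed-bounded = record
            { symbol = N[1-s]≉0 , -A≉0 , not-norm
            ; square = y * proj₁ z-square , ≉0-* (proj₁ (proj₂ square)) (proj₁ (proj₂ z-square)) , (begin
                N z′ * A                        ≈⟨ *-congʳ (proj₂ (proj₂ z-square)) ⟩
                N z * (c₂ * c₂) * A             ≈⟨ solve 3 (λ z c A → z :* (c :* c) :* A := z :* A :* (c :* c)) refl (N z) c₂ A ⟩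
                N z * A * (c₂ * c₂)             ≈⟨ *-congʳ (proj₂ (proj₂ square)) ⟩
                y * y * (c₂ * c₂)               ≈⟨ solve 2 (λ y c → y :* y :* (c :* c) := y :* c :* (y :* c)) refl y c₂ ⟩
                y * c₂ * (y * c₂)               ∎)
            ; bound = ≼-*-transfer (N (ι (π ^ᶻ t) *ᴰ a) ⁻¹) νNz νNz′ bound
            }
            where
            z-square : ∃[ x ] x ≉ 0# × N z′ ≈ N z * (x * x)
            z-square = local-square-theorem ν2 νNz Nz′-Nz-≼
            n-square : ∃[ x ] x ≉ 0# × N (1ᴰ -ᴰ s) ≈ n * (x * x)
            n-square = local-square-theorem ν2 νn N[1-s]-n-≼
            c₁ c₂ : Carrier
            c₁ = proj₁ n-square
            c₂ = proj₁ z-square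
            c₁≉0 : c₁ ≉ 0#
            c₁≉0 = proj₁ (proj₂ n-square)
            N[1-s]≉0 : N (1ᴰ -ᴰ s) ≉ 0#
            N[1-s]≉0 eq = ≉0-* n≉0 (≉0-* c₁≉0 c₁≉0) (trans (sym (proj₂ (proj₂ n-square))) eq)
            not-norm : ¬ HilbertSolvable (N (1ᴰ -ᴰ s)) (- A)
            -- The square factor c₁² between N (1 - s) and n is absorbed into X.
            not-norm (X , Y , Z , nontrivial , eq) = n-not-norm (c₁ * X , Y , Z ,
              (λ (c₁X≈0 , Y≈0 , Z≈0) → nontrivial
                (*-cancelʳ-≉0 c₁≉0 (trans (*-comm X c₁) (trans c₁X≈0 (sym (zeroˡ c₁)))) , Y≈0 , Z≈0)) ,
              trans (+-congʳ (trans
                (solve 3 (λ n c X → n :* (c :* X :* (c :* X)) := n :* (c :* c) :* (X :* X)) refl n c₁ X)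
                (*-congʳ (sym (proj₂ (proj₂ n-square)))))) eq)

      perturbed : ∀ {u} → + 7 ℤ.* e ℤ.≤ u → ∀ s → u ℤ.+ u ≼ N (s -ᴰ r) → KStar a t s
      perturbed 7e≤u =
        let _ , νA = ≉0⇒val A≉0
            _ , νw = ≉0⇒val w≉0
            η , νn = ≉0⇒val n≉0
            -- The trace estimate halves norm valuations, so an odd η is rounded down.
            v , v+v≤η , η≤1+v+v = halve η
        in perturbed-bounded νA νw νn {v = v} 7e≤u v+v≤η η≤1+v+v

    KStar-cong : ∀ {a a′ t r} → a ≈ᴰ a′ → KStar a t r → KStar a′ t r
    KStar-cong {a} {a′} {t} {r} a≈a′ star = record
      { symbol = N≉0 , (λ eq → -N≉0 (trans (-‿cong Na≈Na′) eq)) ,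
                 λ (X , Y , Z , nontrivial , eq) → not-norm (X , Y , Z , nontrivial , trans (+-congˡ (*-congʳ (-‿cong Na≈Na′))) eq)
      ; square = let y , y≉0 , eq = square in y , y≉0 , trans (*-cong (sym Nz≈Nz′) (sym Na≈Na′)) eq
      ; bound  = ≼-cong (*-cong Nz≈Nz′ (⁻¹-cong (N-cong (*ᴰ-cong (≈ᴰ-refl {ι (π ^ᶻ t)}) a≈a′)))) bound
      }
      where
      open KStar star
      N≉0 : N (1ᴰ -ᴰ r) ≉ 0#
      N≉0 = proj₁ symbol
      -N≉0 : - N a ≉ 0#
      -N≉0 = proj₁ (proj₂ symbol)
      not-norm : ¬ HilbertSolvable (N (1ᴰ -ᴰ r)) (- N a)
      not-norm = proj₂ (proj₂ symbol)
      Na≈Na′ : N a ≈ N a′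
      Na≈Na′ = N-cong a≈a′
      Nz≈Nz′ : N (a -ᴰ r *ᴰ a *ᴰ conj r) ≈ N (a′ -ᴰ r *ᴰ a′ *ᴰ conj r)
      Nz≈Nz′ = N-cong (-ᴰ-cong a≈a′ (*ᴰ-cong (*ᴰ-cong ≈ᴰ-refl a≈a′) ≈ᴰ-refl))

    KStar-perturb : ∀ {a t r u} → IsPure a → + 0 ≼ N r → KStar a t r → + 7 ℤ.* e ℤ.≤ u → ∀ s → u ℤ.+ u ≼ N (s -ᴰ r) → KStar a t s
    KStar-perturb {a} {t} {r} a₀≈0 0≼Nr star 7e≤u s h =
      KStar-cong (sym a₀≈0 , refl , refl , refl)
        (Perturbation.perturbed (x₁ a) (x₂ a) (x₃ a) t r 0≼Nr (KStar-cong (a₀≈0 , refl , refl , refl) star) 7e≤u s h)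

    -- Approximating integral quaternions by grid elements.

    fromCoordinates : Carrier → Carrier → Carrier → Carrier → D
    fromCoordinates a b c d = ι a +ᴰ ι b *ᴰ ω +ᴰ ι c *ᴰ i +ᴰ ι d *ᴰ (i *ᴰ ω)

    2[x½]≈x : ∀ x → 2# * (x * 2# ⁻¹) ≈ x
    2[x½]≈x x = begin
      2# * (x * 2# ⁻¹)    ≈⟨ solve 2 (λ x h → twoₚ :* (x :* h) := x :* (twoₚ :* h)) refl x (2# ⁻¹) ⟩
      x * (2# * 2# ⁻¹)    ≈⟨ *-congˡ (inverseʳ (val⇒≉0 ν2)) ⟩
      x * 1#              ≈⟨ *-identityʳ x ⟩
      x                   ∎

    fromCoordinates≈ : ∀ a b c d → fromCoordinates a b c d ≈ᴰ
      quat (a + b * 2# ⁻¹) (c + d * 2# ⁻¹) (b * 2# ⁻¹) (d * 2# ⁻¹)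
    fromCoordinates≈ a b c d =
      solve 7 (λ π Δ h a b c d → y₀ (gridₚ π Δ h a b c d) := a :+ b :* h) refl π Δ (2# ⁻¹) a b c d ,
      solve 7 (λ π Δ h a b c d → y₁ (gridₚ π Δ h a b c d) := c :+ d :* h) refl π Δ (2# ⁻¹) a b c d ,
      solve 7 (λ π Δ h a b c d → y₂ (gridₚ π Δ h a b c d) := b :* h) refl π Δ (2# ⁻¹) a b c d ,
      solve 7 (λ π Δ h a b c d → y₃ (gridₚ π Δ h a b c d) := d :* h) refl π Δ (2# ⁻¹) a b c d
      where
      open Quatₚ
      gridₚ : ∀ {n} (π Δ h a b c d : Polynomial n) → Quatₚ n
      gridₚ π Δ h a b c d = ιₚ a ⊕ mulₚ π Δ (ιₚ b) ωₚ ⊕ mulₚ π Δ (ιₚ c) iₚ ⊕ mulₚ π Δ (ιₚ d) (mulₚ π Δ iₚ ωₚ)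
        where
        ιₚ : Polynomial _ → Quatₚ _
        ιₚ x = quatₚ x zeroₚ zeroₚ zeroₚ
        iₚ ωₚ : Quatₚ _
        iₚ = quatₚ zeroₚ oneₚ zeroₚ zeroₚ
        ωₚ = mulₚ π Δ (ιₚ h) (ιₚ oneₚ ⊕ quatₚ zeroₚ zeroₚ oneₚ zeroₚ)

    coordinates-fromCoordinates : ∀ a b c d → let q = fromCoordinates a b c d in
      (x₀ q - x₂ q ≈ a × 2# * x₂ q ≈ b) × (x₁ q - x₃ q ≈ c × 2# * x₃ q ≈ d)
    coordinates-fromCoordinates a b c d = let q₀ , q₁ , q₂ , q₃ = fromCoordinates≈ a b c d in
      (trans (+-cong q₀ (-‿cong q₂)) (cancel a (b * 2# ⁻¹)) , trans (*-congˡ q₂) (2[x½]≈x b)) ,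
      (trans (+-cong q₁ (-‿cong q₃)) (cancel c (d * 2# ⁻¹)) , trans (*-congˡ q₃) (2[x½]≈x d))
      where
      cancel : ∀ x y → x + y - y ≈ x
      cancel = solve 2 (λ x y → x :+ y :- y := x) refl

    module _ {ℓ′} {I : Pred Carrier ℓ′} (S : Representatives I) where

      open Representatives S

      grid-integral : ∀ {q} → q ∈ Grid S → + 0 ≼ N q
      grid-integral (a , b , c , d , q≈) =
        let (eₐ , e_b) , (e_c , e_d) = coordinates-fromCoordinates (rep a) (rep b) (rep c) (rep d) in
        ≼-cong (sym (N-cong q≈)) (coordinates≼⇒N≼ (fromCoordinates (rep a) (rep b) (rep c) (rep d))
          ((≼-cong (sym eₐ) (integral a) , ≼-cong (sym e_b) (integral b)) ,
           (≼-cong (sym e_c) (integral c) , ≼-cong (sym e_d) (integral d))))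

      -- Integrality of N r passes to the four coordinates of r, and each is replaced by its
      -- representative. The norm is quadratic in the coordinates, whence u + u.
      grid-approximates : ∀ {u} → (∀ {x} → x ∈ I → u ≼ x) → ∀ r → + 0 ≼ N r → ∃[ s ] s ∈ Grid S × u ℤ.+ u ≼ N (s -ᴰ r)
      grid-approximates {u} I⊆ r 0≼Nr =
        let (h₀ , h₂) , (h₁ , h₃) = N≼⇒coordinates≼ {+ 0} r 0≼Nr
            a , ha = covers _ h₀
            b , hb = covers _ h₂
            c , hc = covers _ h₁
            d , hd = covers _ h₃
            s = fromCoordinates (rep a) (rep b) (rep c) (rep d)
            (eₐ , e_b) , (e_c , e_d) = coordinates-fromCoordinates (rep a) (rep b) (rep c) (rep d)
        in s , (a , b , c , d , ≈ᴰ-refl) , coordinates≼⇒N≼ (s -ᴰ r)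
          ((close-- (x₀ s) (x₂ s) (x₀ r) (x₂ r) eₐ ha , close-2* (x₂ s) (x₂ r) e_b hb) ,
           (close-- (x₁ s) (x₃ s) (x₁ r) (x₃ r) e_c hc , close-2* (x₃ s) (x₃ r) e_d hd))
        where
        close : ∀ {p y g} → g ≈ y → p - y ∈ I → u ≼ g - p
        close {p} {y} g≈y h = ≼-cong (trans (solve 2 (λ p y → :- (p :- y) := y :- p) refl p y) (+-congʳ (sym g≈y))) (≼-neg (I⊆ h))
        close-- : ∀ x x′ y y′ {g} → x - x′ ≈ g → (y - y′) - g ∈ I → u ≼ (x - y) - (x′ - y′)
        close-- x x′ y y′ eq h = ≼-cong (solve 4 (λ x x′ y y′ → (x :- x′) :- (y :- y′) := (x :- y) :- (x′ :- y′)) refl x x′ y y′) (close eq h)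
        close-2* : ∀ x y {g} → 2# * x ≈ g → 2# * y - g ∈ I → u ≼ 2# * (x - y)
        close-2* x y eq h = ≼-cong (solve 2 (λ x y → twoₚ :* x :- twoₚ :* y := twoₚ :* (x :- y)) refl x y) (close eq h)

-- Integral solutions against grid solutions.

theorem4 : ∀ {c ℓ} (k : DyadicLocalField c ℓ) → let open DyadicLocalField k in
    (π : Carrier) → IsUniformizer π →
    (Δ δ : Carrier) → IsMinimalDefectUnit Δ → δ ∈ 𝒪* → Δ ≈ 1# + 4# * δ →
    let open QuaternionAlgebra k π Δ in
    (a₁ a₂ : D) → a₁ ≉ᴰ 0ᴰ → a₂ ≉ᴰ 0ᴰ → IsPure a₁ → IsPure a₂ →
    ∣ ι 2# *ᴰ a₁ ∣ ℚ.≥ ∣ a₂ ∣ →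
    (∃[ s ] s ∈ k*² × N a₂ ≈ N a₁ * s) →
    (t : ℤ) → ν (ι (π ^ᶻ t)) +∞ ν a₁ ≡ ν a₂ →
    (e : ℕ) → IsRamificationIndex π e →
    (S : Representatives ((π ^ᶻ (t ℤ.+ + (6 ℕ.* e))) 𝒪-ideal)) →
    (∃[ r ] r ∈ 𝒪ᴰ × KStar a₁ t r) ⇔ (∃[ α ] α ∈ Grid S × KStar a₁ t α)
theorem4 k π νπ Δ δ Δ-minimal δ-unit Δ≈1+4δ a₁ a₂ _ _ a₁-pure _ ∣a₂∣≤∣2a₁∣ _ t νa₂ e ramification S = mk⇔ to from
  where
  open DyadicLocalField k
  open QuaternionAlgebra k π Δ
  open ValuationProperties k
  open LocalSquares k
  open AbsoluteValue k
  open QuaternionIdentities k π Δ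
  open RingProperties ring using (-0#≈0#)
  open Dyadic k

  ν2 : Val 2# (+ e)
  ν2 = ramification⇒val-2 νπ ramification

  open DivisionAlgebra ν2 π νπ Δ δ (nonzeroDefect⇒nonsquare (IsMinimalDefectUnit.nonzero Δ-minimal)) (proj₁ δ-unit) Δ≈1+4δ

  u : ℤ
  u = t ℤ.+ + (6 ℕ.* e)

  -- The norm of `ι (π ^ᶻ t)` is π^(2t), so ν (a₂) = 2t + ν (a₁), while |2a₁| ≥ |a₂| reads 2e + ν
  -- (a₁) ≤ ν (a₂).
  e≤t : ∀ {n} → Val (N a₁) n → + e ℤ.≤ t
  e≤t {n} νa₁ = halve-double-≤ (cancel (+ e ℤ.+ + e) (t ℤ.+ t) n (∣∣≤⇒val≤
      (≡.trans (≡.sym νa₂) (≡.cong₂ _+∞_ (val-cong (sym (N-ι (π ^ᶻ t))) (val-* (val-^ᶻ νπ t) (val-^ᶻ νπ t))) νa₁))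
      (val-cong (sym (trans (N-* (ι 2#) a₁) (*-congʳ (N-ι 2#)))) (val-* (val-* ν2 ν2) νa₁))
      ∣a₂∣≤∣2a₁∣))
    where
    cancel : ∀ i j n → i ℤ.+ n ℤ.≤ j ℤ.+ n → i ℤ.≤ j
    cancel i j n h = ≤-by-difference h (ℤ-solve (i ∷ j ∷ n ∷ []))

  7e≤u : ∀ {n} → Val (N a₁) n → + 7 ℤ.* + e ℤ.≤ u
  7e≤u νa₁ = ≡.subst (λ i → + 7 ℤ.* + e ℤ.≤ t ℤ.+ i) (≡.sym (ℤ.pos-* 6 e)) (add (+ e) (e≤t νa₁))
    where
    add : ∀ i → i ℤ.≤ t → + 7 ℤ.* i ℤ.≤ t ℤ.+ + 6 ℤ.* i
    add i h = ≤-by-difference h (ℤ-solve (i ∷ t ∷ []))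

  ideal-≼ : ∀ {x} → x ∈ (π ^ᶻ u) 𝒪-ideal → u ≼ x
  ideal-≼ (y , 0≼y , x≈) = ≼-cong (sym x≈) (≡.subst (_≼ π ^ᶻ u * y) (ℤ.+-identityʳ u) (≼-* (val⇒≼ (val-^ᶻ νπ u)) 0≼y))

  to : (∃[ r ] r ∈ 𝒪ᴰ × KStar a₁ t r) → (∃[ α ] α ∈ Grid S × KStar a₁ t α)
  to (r , ∣r∣≤1 , star) =
    let 0≼Nr = ∣∣≤1⇒integral (N r) ∣r∣≤1
        -- A symbol value presupposes nonzero entries, so `N a₁` has a finite valuation.
        _ , νa₁ = ≉0⇒val {N a₁} λ Na₁≈0 → proj₁ (proj₂ (KStar.symbol star)) (trans (-‿cong Na₁≈0) -0#≈0#)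
        s , s∈Grid , close = grid-approximates S ideal-≼ r 0≼Nr
    in s , s∈Grid , KStar-perturb a₁-pure 0≼Nr star (7e≤u νa₁) s close

  from : (∃[ α ] α ∈ Grid S × KStar a₁ t α) → (∃[ r ] r ∈ 𝒪ᴰ × KStar a₁ t r)
  -- Grid elements are integral, so α itself serves as r.
  from (α , α∈Grid , star) = α , integral⇒∣∣≤1 (N α) (grid-integral S α∈Grid) , star
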